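{- Let $n>2$, $1<k<n$, $G=H_B(n,k)$. For $h\ge 1$ let $d^{(h)}$ be the number of unordered pairs $\{u,v\}$ of vertices of $G$ with $d(u,v)=h$; let $d^{(2)}_{V_1}$ be the number of unordered pairs of vertices of $V_1$ at distance $2$, and $d^{(2)}_{V_2}$, $d^{(4)}_{V_2}$ the numbers of unordered pairs of vertices of $V_2$ at distance $2$ and $4$ respectively. Then (1) $d^{(1)}=\binom{n}{k}\left(\frac{3^k-3}{2}+2^{k-1}(3^{n-k}-1)\right)$; (2) $d^{(3)}=\binom{n}{k}\left(\frac{3^n-1}{2}-\binom{n}{k}-\frac{3^k-3}{2}-2^{k-1}(3^{n-k}-1)\right)$; (3) $d^{(2)}_{V_1}=\binom{\binom{n}{k}}{2}$; (4) $d^{(2)}_{V_2}+d^{(4)}_{V_2}=\binom{\frac{3^n-1}{2}-\binom{n}{k}}{2}$.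
   Context: Fix integers $n\ge 2$ and $1\le k<n$ and positive real numbers $x_1<x_2<\dots<x_n$. Let $\mathscr{B}_n=\{\pm x_1,\pm x_2,\dots,\pm x_{n-1},x_n\}$ (so $-x_n\notin\mathscr{B}_n$). Let $\phi(\mathscr{B}_n)$ be the family of all nonempty subsets $S\subseteq\mathscr{B}_n$ whose elements have pairwise distinct absolute values and whose element of largest absolute value is positive. Let $\mathscr{B}_n^+=\{x_1,\dots,x_n\}$, let $V_1$ be the set of all $k$-element subsets of $\mathscr{B}_n^+$, and let $V_2=\phi(\mathscr{B}_n)\setminus V_1$. For $A\in\phi(\mathscr{B}_n)$ put $A^\dagger=\{|a|:a\in A\}$. The bipartite Kneser B type-$k$ graph $H_B(n,k)$ is the simple graph with vertex set $V_1\cup V_2$ in which $X\in V_1$ and $Y\in V_2$ are adjacent if and only if $X\subseteq Y^\dagger$ or $Y^\dagger\subseteq X$, and there are no other edges. $d(u,v)$ denotes graph distance. -}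

module Defs where

open import Level using (0ℓ)
open import Data.Nat.Base as ℕ using (ℕ; suc; _∸_)
import Data.Nat.Properties as ℕ
open import Data.Rational.Base as ℚ using (ℚ; 0ℚ)
import Data.Rational.Properties as ℚ
open import Algebra.Properties.Group ℚ.+-0-group using (⁻¹-involutive)
open import Data.Fin.Base using (Fin; splitAt; inject≤)
open import Data.Fin.Subset using (Subset; _∈_; ∣_∣)
open import Data.Product.Base using (∃-syntax; _×_; _,_; proj₁; proj₂)
open import Data.Sum.Base using (_⊎_; inj₁; inj₂; [_,_]′; swap)
open import Function.Base using (_∘_)
open import Function.Bundles using (Bijection)
open import Relation.Nullary using (¬_)
open import Relation.Unary as Pred using (Pred)
open import Relation.Binary.Core using (Rel)
open import Relation.Binary.Bundles using (Setoid)
open import Relation.Binary.Structures using (IsEquivalence)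
open import Relation.Binary.Definitions using (Symmetric; _Respects₂_)
import Relation.Binary.Construct.On as On
open import Relation.Binary.PropositionalEquality
  using (_≡_; refl; sym; trans; cong; subst; setoid; module ≡-Reasoning)

-- Real numbers, as Cauchy sequences of rationals.  Equality of reals is _≈_.

IsCauchy : (ℕ → ℚ) → Set
IsCauchy s = ∀ ε → 0ℚ ℚ.< ε →
  ∃[ N ] ∀ m n → N ℕ.≤ m → N ℕ.≤ n → ℚ.∣ s m ℚ.- s n ∣ ℚ.< ε

record ℝ : Set where
  constructor mkℝ
  field
    seq    : ℕ → ℚ
    cauchy : IsCauchy seq

open ℝ public

infix 4 _≈_ _<_ _≤_

_≈_ : Rel ℝ 0ℓ
x ≈ y = ∀ ε → 0ℚ ℚ.< ε →
  ∃[ N ] ∀ n → N ℕ.≤ n → ℚ.∣ seq x n ℚ.- seq y n ∣ ℚ.< ε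

_<_ : Rel ℝ 0ℓ
x < y = ∃[ ε ] 0ℚ ℚ.< ε ×
  ∃[ N ] ∀ n → N ℕ.≤ n → seq x n ℚ.+ ε ℚ.≤ seq y n

_≤_ : Rel ℝ 0ℓ
x ≤ y = ¬ (y < x)

private
  ∣p-q∣≡∣q-p∣ : ∀ p q → ℚ.∣ p ℚ.- q ∣ ≡ ℚ.∣ q ℚ.- p ∣
  ∣p-q∣≡∣q-p∣ p q = trans (sym (ℚ.∣-p∣≡∣p∣ (p ℚ.- q))) (cong ℚ.∣_∣ (begin
    ℚ.- (p ℚ.- q)            ≡⟨ ℚ.neg-distrib-+ p (ℚ.- q) ⟩
    ℚ.- p ℚ.+ ℚ.- (ℚ.- q)    ≡⟨ cong (ℚ.- p ℚ.+_) (⁻¹-involutive q) ⟩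
    ℚ.- p ℚ.+ q              ≡⟨ ℚ.+-comm (ℚ.- p) q ⟩
    q ℚ.- p                  ∎))
    where open ≡-Reasoning

  ∣p∣-∣q∣≤∣p-q∣ : ∀ p q → ℚ.∣ p ∣ ℚ.- ℚ.∣ q ∣ ℚ.≤ ℚ.∣ p ℚ.- q ∣
  ∣p∣-∣q∣≤∣p-q∣ p q = begin
    ℚ.∣ p ∣ ℚ.- ℚ.∣ q ∣                            ≡⟨ cong (λ r → ℚ.∣ r ∣ ℚ.- ℚ.∣ q ∣) p≡p-q+q ⟩
    ℚ.∣ p ℚ.- q ℚ.+ q ∣ ℚ.- ℚ.∣ q ∣                ≤⟨ ℚ.+-monoˡ-≤ (ℚ.- ℚ.∣ q ∣) (ℚ.∣p+q∣≤∣p∣+∣q∣ (p ℚ.- q) q) ⟩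
    ℚ.∣ p ℚ.- q ∣ ℚ.+ ℚ.∣ q ∣ ℚ.- ℚ.∣ q ∣          ≡⟨ ℚ.+-assoc ℚ.∣ p ℚ.- q ∣ ℚ.∣ q ∣ (ℚ.- ℚ.∣ q ∣) ⟩
    ℚ.∣ p ℚ.- q ∣ ℚ.+ (ℚ.∣ q ∣ ℚ.- ℚ.∣ q ∣)        ≡⟨ cong (ℚ.∣ p ℚ.- q ∣ ℚ.+_) (ℚ.+-inverseʳ ℚ.∣ q ∣) ⟩
    ℚ.∣ p ℚ.- q ∣ ℚ.+ 0ℚ                           ≡⟨ ℚ.+-identityʳ _ ⟩
    ℚ.∣ p ℚ.- q ∣                                  ∎
    where
    open ℚ.≤-Reasoning
    p≡p-q+q : p ≡ p ℚ.- q ℚ.+ q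
    p≡p-q+q = sym (trans (ℚ.+-assoc p (ℚ.- q) q)
      (trans (cong (p ℚ.+_) (ℚ.+-inverseˡ q)) (ℚ.+-identityʳ p)))

  p≤q⇒0≤q-p : ∀ {p q} → p ℚ.≤ q → 0ℚ ℚ.≤ q ℚ.- p
  p≤q⇒0≤q-p {p} {q} p≤q =
    subst (ℚ._≤ q ℚ.- p) (ℚ.+-inverseʳ p) (ℚ.+-monoˡ-≤ (ℚ.- p) p≤q)

  ∣∣p∣-∣q∣∣≤∣p-q∣ : ∀ p q → ℚ.∣ ℚ.∣ p ∣ ℚ.- ℚ.∣ q ∣ ∣ ℚ.≤ ℚ.∣ p ℚ.- q ∣
  ∣∣p∣-∣q∣∣≤∣p-q∣ p q with ℚ.≤-total ℚ.∣ q ∣ ℚ.∣ p ∣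
  ... | inj₁ q≤p = subst (ℚ._≤ ℚ.∣ p ℚ.- q ∣)
    (sym (ℚ.0≤p⇒∣p∣≡p (p≤q⇒0≤q-p q≤p))) (∣p∣-∣q∣≤∣p-q∣ p q)
  ... | inj₂ p≤q = subst (ℚ._≤ ℚ.∣ p ℚ.- q ∣)
    (sym (trans (∣p-q∣≡∣q-p∣ ℚ.∣ p ∣ ℚ.∣ q ∣) (ℚ.0≤p⇒∣p∣≡p (p≤q⇒0≤q-p p≤q))))
    (subst (ℚ.∣ q ∣ ℚ.- ℚ.∣ p ∣ ℚ.≤_) (∣p-q∣≡∣q-p∣ q p) (∣p∣-∣q∣≤∣p-q∣ q p))

0ℝ : ℝ
0ℝ = mkℝ (λ _ → 0ℚ) λ ε 0<ε → 0 , λ _ _ _ _ → 0<ε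

-_ : ℝ → ℝ
- mkℝ s c = mkℝ (ℚ.-_ ∘ s) λ ε 0<ε →
  proj₁ (c ε 0<ε) , λ m n N≤m N≤n →
    subst (ℚ._< ε) (eq (s m) (s n)) (proj₂ (c ε 0<ε) m n N≤m N≤n)
  where
  eq : ∀ p q → ℚ.∣ p ℚ.- q ∣ ≡ ℚ.∣ ℚ.- p ℚ.- ℚ.- q ∣
  eq p q = trans (sym (ℚ.∣-p∣≡∣p∣ (p ℚ.- q))) (cong ℚ.∣_∣ (ℚ.neg-distrib-+ p (ℚ.- q)))

abs : ℝ → ℝ
abs (mkℝ s c) = mkℝ (ℚ.∣_∣ ∘ s) λ ε 0<ε →
  proj₁ (c ε 0<ε) , λ m n N≤m N≤n →
    ℚ.≤-<-trans (∣∣p∣-∣q∣∣≤∣p-q∣ (s m) (s n)) (proj₂ (c ε 0<ε) m n N≤m N≤n)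

-- Simple graphs.  Vertices form a setoid, so that a vertex may carry a proof
-- of membership in the vertex set without that proof affecting its identity.

record SimpleGraph : Set₁ where
  field
    vertices : Setoid 0ℓ 0ℓ
  open Setoid vertices public
    using () renaming (Carrier to V; _≈_ to _≈ᵥ_; isEquivalence to ≈ᵥ-isEquivalence)
  field
    Adj      : Rel V 0ℓ
    adj-resp : Adj Respects₂ _≈ᵥ_
    adj-sym  : Symmetric Adj
    adj-irr  : ∀ {u v} → u ≈ᵥ v → ¬ Adj u v

module _ (G : SimpleGraph) where
  open SimpleGraph G

  data Walk : ℕ → V → V → Set where
    nil  : ∀ {u v} → u ≈ᵥ v → Walk 0 u v
    cons : ∀ {h u v w} → Adj u v → Walk h v w → Walk (suc h) u w

  Distance : V → V → ℕ → Set
  Distance u v h = Walk h u v × (∀ m → m ℕ.< h → ¬ Walk m u v)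

  -- Unordered pairs {u , v} of vertices satisfying P with d(u , v) = h.  The
  -- setoid equality identifies (u , v) with (v , u).
  PairsAtDistance : Pred V 0ℓ → ℕ → Setoid 0ℓ 0ℓ
  PairsAtDistance P h = record
    { Carrier = ∃[ u ] ∃[ v ] P u × P v × Distance u v h
    ; _≈_     = λ (u , v , _) (u′ , v′ , _) →
                  (u ≈ᵥ u′ × v ≈ᵥ v′) ⊎ (u ≈ᵥ v′ × v ≈ᵥ u′)
    ; isEquivalence = record
      { refl  = inj₁ (E.refl , E.refl)
      ; sym   = λ { (inj₁ (p , q)) → inj₁ (E.sym p , E.sym q)
                  ; (inj₂ (p , q)) → inj₂ (E.sym q , E.sym p) }
      ; trans = λ { (inj₁ (p , q)) (inj₁ (r , s)) → inj₁ (E.trans p r , E.trans q s)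
                  ; (inj₁ (p , q)) (inj₂ (r , s)) → inj₂ (E.trans p r , E.trans q s)
                  ; (inj₂ (p , q)) (inj₁ (r , s)) → inj₂ (E.trans p s , E.trans q r)
                  ; (inj₂ (p , q)) (inj₂ (r , s)) → inj₁ (E.trans p s , E.trans q r) }
      }
    }
    where module E = IsEquivalence ≈ᵥ-isEquivalence

infix 4 _HasSize_

_HasSize_ : Setoid 0ℓ 0ℓ → ℕ → Set
A HasSize N = Bijection A (setoid (Fin N))

module BipartiteKneserB (n k : ℕ) (x : Fin n → ℝ) where

  -- The listing x₁ , … , xₙ , - x₁ , … , - xₙ₋₁ of 𝓑ₙ.  It has no repetitions
  -- when 0 < x₁ < … < xₙ, so subsets of 𝓑ₙ are subsets of the index set.
  b : Fin (n ℕ.+ (n ∸ 1)) → ℝ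
  b i = [ x , (λ j → - x (inject≤ j (ℕ.m∸n≤m n 1))) ]′ (splitAt n i)

  SubsetB : Set
  SubsetB = Subset (n ℕ.+ (n ∸ 1))

  ⟦_⟧ : SubsetB → Pred ℝ 0ℓ
  ⟦ S ⟧ r = ∃[ i ] i ∈ S × r ≈ b i

  _† : SubsetB → Pred ℝ 0ℓ
  (S †) r = ∃[ i ] i ∈ S × r ≈ abs (b i)

  B⁺ : Pred ℝ 0ℓ
  B⁺ r = ∃[ j ] r ≈ x j

  DistinctAbs : SubsetB → Set
  DistinctAbs S = ∀ {i j} → i ∈ S → j ∈ S → abs (b i) ≈ abs (b j) → i ≡ j

  -- In particular, S is nonempty.
  LargestPositive : SubsetB → Set
  LargestPositive S =
    ∃[ i ] i ∈ S × (∀ {j} → j ∈ S → abs (b j) ≤ abs (b i)) × 0ℝ < b i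

  φ : Pred SubsetB 0ℓ
  φ S = DistinctAbs S × LargestPositive S

  V₁ : Pred SubsetB 0ℓ
  V₁ S = ⟦ S ⟧ Pred.⊆ B⁺ × ∣ S ∣ ≡ k

  V₂ : Pred SubsetB 0ℓ
  V₂ S = φ S × ¬ V₁ S

  Joined : Rel SubsetB 0ℓ
  Joined X Y = V₁ X × V₂ Y × (⟦ X ⟧ Pred.⊆ Y † ⊎ Y † Pred.⊆ ⟦ X ⟧)

  Vertex : Set
  Vertex = ∃[ S ] (V₁ S ⊎ V₂ S)

  H : SimpleGraph
  H = record
    { vertices = On.setoid {B = Vertex} (setoid SubsetB) proj₁
    ; Adj      = λ (X , _) (Y , _) → Joined X Y ⊎ Joined Y X
    ; adj-resp = (λ { refl a → a }) , (λ { refl a → a })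
    ; adj-sym  = swap
    ; adj-irr  = λ { refl (inj₁ (v₁ , (_ , ¬v₁) , _)) → ¬v₁ v₁
                   ; refl (inj₂ (v₁ , (_ , ¬v₁) , _)) → ¬v₁ v₁ }
    }

  pairs : ℕ → Setoid 0ℓ 0ℓ
  pairs = PairsAtDistance H Pred.U

  pairsV₁ : ℕ → Setoid 0ℓ 0ℓ
  pairsV₁ = PairsAtDistance H (V₁ ∘ proj₁)

  pairsV₂ : ℕ → Setoid 0ℓ 0ℓ
  pairsV₂ = PairsAtDistance H (V₂ ∘ proj₁)

{-# OPTIONS --safe #-}

-- A member of φ(𝓑ₙ) is its vector of signs in {0 , + , -}ⁿ, with last nonzero sign +, and X ∈ V₁,
-- Y ∈ V₂ are adjacent iff their supports are nested.  The full positive set lies in V₂ and is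
-- adjacent to all of V₁, and every Y ∈ V₂ has a neighbour, since some k-set is comparable with its
-- support.  Hence distances are at most 2 inside V₁, 3 across, and 4 inside V₂; by parity, only the
-- degree of a vertex of V₁ and the sizes of V₁ and V₂ remain to be counted.  Flipping all signs
-- pairs off the nonzero sign vectors, so 2 #{t leading with + : Q (supp t)} + [Q ∅] counts all
-- sign vectors with Q (supp t), and the latter counts are products over the coordinates.

module Submission where

open import Defs
open import Data.Nat.Base using (ℕ; _+_; _*_; _∸_; _^_; _/_) renaming (_<_ to _<ℕ_)
open import Data.Nat.Combinatorics using (_C_)
open import Data.Fin.Base using (Fin) renaming (_<_ to _<ᶠ_)
open import Data.Product.Base using (∃-syntax; _×_)
open import Relation.Binary.PropositionalEquality using (_≡_)

open import Level using (0ℓ)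
open import Algebra.Properties.Group using (⁻¹-anti-homo-//)
open import Data.Bool.Base using (Bool; true; false; T; not; _∧_; _∨_)
open import Data.Bool.Properties using (T?; not-involutive; ∧-identityʳ; ∧-zeroʳ; T-∧; T-∨)
open import Data.Nat.Base as ℕ using (zero; suc; s≤s; z≤n; _≡ᵇ_)
import Data.Nat.Properties as ℕ
open import Data.Nat.Combinatorics using (nC1≡n; nCk+nC[k+1]≡[n+1]C[k+1])
open import Data.Nat.DivMod using (m*n/n≡m)
open import Data.Nat.Tactic.RingSolver using (solve-∀)
open import Data.Rational.Base as ℚ using (ℚ; 0ℚ)
import Data.Rational.Properties as ℚ
open import Data.Fin.Base as Fin using (zero; suc; toℕ; fromℕ<; splitAt; inject≤; _↑ˡ_; _↑ʳ_)
import Data.Fin.Properties as Fin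
open import Data.Fin.Subset as Subset using (Subset; inside; outside; ⊥; ⊤; ∁; ∣_∣; _⊆_)
open import Data.Fin.Subset.Properties
open import Data.List.Base as List
  using (List; []; _∷_; _++_; map; length; filter; filterᵇ; cartesianProduct; cartesianProductWith)
open import Data.List.Properties using (length-map; length-++; filter-++; filter-all)
open import Data.List.Membership.Propositional using (_∈_; _∉_; find; lose)
open import Data.List.Membership.Propositional.Properties
  using ( ∈-lookup; ∈-map⁺; ∈-map⁻; ∈-++⁺ˡ; ∈-++⁺ʳ; ∈-++⁻; ∈-filter⁺; ∈-filter⁻
        ; ∈-cartesianProduct⁺; ∈-cartesianProduct⁻; ∈-cartesianProductWith⁺ )
open import Data.List.Relation.Unary.All as All using (All; []; _∷_)
open import Data.List.Relation.Unary.AllPairs using ([]; _∷_)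
open import Data.List.Relation.Unary.Any as Any using (Any; here; there; any?)
open import Data.List.Relation.Unary.Any.Properties using (lookup-index)
open import Data.List.Relation.Unary.Unique.Propositional using (Unique)
import Data.List.Relation.Unary.Unique.Propositional.Properties as Unique
open import Data.Vec.Base as Vec using (Vec; []; _∷_; lookup; tabulate)
open import Data.Vec.Properties
  using (∷-injective; lookup⇒[]=; []=⇒lookup; lookup-map; lookup∘tabulate; tabulate∘lookup; tabulate-cong)
open import Data.Product.Base using (_,_; proj₁; proj₂)
open import Data.Product.Properties using (,-injectiveʳ)
open import Data.Sum.Base as Sum using (_⊎_; inj₁; inj₂; [_,_]′)
open import Data.Unit.Base using (tt)
open import Function.Base using (_∘_; id; const)
open import Function.Bundles using (_⇔_; mk⇔; Equivalence)
open import Relation.Nullary using (¬_; contradiction; yes; no; does; ¬?; _×-dec_)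
open import Relation.Nullary.Decidable using (dec-true; dec-false)
open import Relation.Unary as Pred using (Pred; Decidable; U)
open import Relation.Unary.Properties using (U?)
open import Relation.Binary.Core using (Rel)
open import Relation.Binary.Bundles using (Setoid)
open import Relation.Binary.Definitions using (DecidableEquality; tri<; tri≈; tri>)
open import Relation.Binary.PropositionalEquality
  using (_≢_; _≗_; refl; sym; trans; cong; cong₂; subst; subst₂; module ≡-Reasoning)

-- Comparison of reals is not decidable in general, yet each family of pairs must be put in
-- bijection with some `Fin`. So every vertex gets a code, its sign vector, on which adjacency and
-- the existence of a common neighbour are decidable. This is what gives the pairs at distance 2 and
-- those at distance 4 inside V₂ a definite number each, of which the theorem states the sum. Reals
-- occur only in the translation: since `x` is positive and strictly increasing, comparing absolute
-- values amounts to comparing indices.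
--
-- An unordered pair is counted through whichever of its two orderings occurs in a duplicate-free
-- list that never contains both.
--
-- Origin of the degree: let p be the support of X, of size k. Half of the 3^k - 1 nonzero vectors
-- with support below p lead with a plus, as do half of the 2^k 3^(n-k) vectors with support above
-- p; the 2^(k-1) vectors with support p are counted twice, which turns 3^(n-k) into 3^(n-k) - 1. X
-- is nested with itself but lies in V₁; dropping it turns (3^k - 1)/2 into (3^k - 3)/2. The
-- identities behind this are kept additive, because `∸` truncates.

private variable
  A : Set
  n : ℕ

-- Sizes of setoids and lists


lookup-injective : {xs : List A} → Unique xs → ∀ i j → List.lookup xs i ≡ List.lookup xs j → i ≡ j
lookup-injective (_  ∷ _)   zero    zero    _  = refl
lookup-injective (x∉ ∷ _)   zero    (suc j) eq = contradiction eq (All.lookup x∉ (∈-lookup j))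
lookup-injective (x∉ ∷ _)   (suc i) zero    eq = contradiction (sym eq) (All.lookup x∉ (∈-lookup i))
lookup-injective (_  ∷ xs!) (suc i) (suc j) eq = cong suc (lookup-injective xs! i j eq)

module _ (S : Setoid 0ℓ 0ℓ) where

  open Setoid S using (Carrier) renaming (_≈_ to _≈ₛ_)

  -- An element is sent to the position of its key. Two elements with equal keys may come with
  -- different membership proofs, but in a duplicate-free list the position depends on the key
  -- alone.
  hasSize : {xs : List A} → Unique xs → (key : Carrier → A) →
            (∀ {a b} → a ≈ₛ b → key a ≡ key b) → (∀ {a b} → key a ≡ key b → a ≈ₛ b) →
            (∀ a → key a ∈ xs) → (∀ {y} → y ∈ xs → ∃[ a ] key a ≡ y) →
            S HasSize length xs
  hasSize {xs = xs} xs! key key-cong key-inj key∈ preimage = record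
    { to        = to
    ; cong      = to-cong ∘ key-cong
    ; bijective =
        (λ {a} {b} eq → key-inj (trans (lookup-to a) (trans (cong (List.lookup xs) eq) (sym (lookup-to b))))) ,
        λ i → let a , eq = preimage (∈-lookup i) in
          a , λ {b} b≈a → lookup-injective xs! (to b) i (trans (sym (lookup-to b)) (trans (key-cong b≈a) eq))
    }
    where
    to : Carrier → Fin (length xs)
    to a = Any.index (key∈ a)
    lookup-to : ∀ a → key a ≡ List.lookup xs (to a)
    lookup-to a = lookup-index (key∈ a)
    to-cong : ∀ {a b} → key a ≡ key b → to a ≡ to b
    to-cong {a} {b} eq = lookup-injective xs! (to a) (to b) (trans (sym (lookup-to a)) (trans eq (lookup-to b)))

-- For a duplicate-free list these are its two-element subsets, each listed once, in the order in
-- which its members occur.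
pairsOf : List A → List (A × A)
pairsOf []       = []
pairsOf (x ∷ xs) = map (x ,_) xs ++ pairsOf xs

length-pairsOf : (xs : List A) → length (pairsOf xs) ≡ length xs C 2
length-pairsOf []       = refl
length-pairsOf (x ∷ xs) = begin
  length (map (x ,_) xs ++ pairsOf xs)        ≡⟨ length-++ (map (x ,_) xs) ⟩
  length (map (x ,_) xs) + length (pairsOf xs) ≡⟨ cong₂ _+_ (length-map (x ,_) xs) (length-pairsOf xs) ⟩
  m + m C 2                                    ≡⟨ cong (_+ m C 2) (nC1≡n m) ⟨
  m C 1 + m C 2                                ≡⟨ nCk+nC[k+1]≡[n+1]C[k+1] m 1 ⟩
  suc m C 2                                    ∎
  where
  open ≡-Reasoning
  m = length xs

∈-pairsOf⁻ : ∀ (xs : List A) {a b} → (a , b) ∈ pairsOf xs → a ∈ xs × b ∈ xs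
∈-pairsOf⁻ (x ∷ xs) p with ∈-++⁻ (map (x ,_) xs) p
... | inj₁ q with _ , b∈ , refl ← ∈-map⁻ (x ,_) q = here refl , there b∈
... | inj₂ q = let a∈ , b∈ = ∈-pairsOf⁻ xs q in there a∈ , there b∈

∈-pairsOf⁺ : ∀ {xs : List A} {a b} → a ∈ xs → b ∈ xs → a ≢ b →
             (a , b) ∈ pairsOf xs ⊎ (b , a) ∈ pairsOf xs
∈-pairsOf⁺ (here refl) (here refl) a≢b = contradiction refl a≢b
∈-pairsOf⁺ (here refl) (there b∈)  a≢b = inj₁ (∈-++⁺ˡ (∈-map⁺ _ b∈))
∈-pairsOf⁺ (there a∈)  (here refl) a≢b = inj₂ (∈-++⁺ˡ (∈-map⁺ _ a∈))
∈-pairsOf⁺ {xs = x ∷ xs} (there a∈) (there b∈) a≢b with ∈-pairsOf⁺ a∈ b∈ a≢b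
... | inj₁ p = inj₁ (∈-++⁺ʳ (map (x ,_) xs) p)
... | inj₂ p = inj₂ (∈-++⁺ʳ (map (x ,_) xs) p)

pairsOf-asym : ∀ {xs : List A} → Unique xs → ∀ {a b} → (a , b) ∈ pairsOf xs → (b , a) ∉ pairsOf xs
pairsOf-asym {xs = x ∷ xs} (x∉ ∷ xs!) p q with ∈-++⁻ (map (x ,_) xs) p | ∈-++⁻ (map (x ,_) xs) q
... | inj₂ p′ | inj₂ q′ = pairsOf-asym xs! p′ q′
... | inj₁ p′ | inj₂ q′ with _ , _ , refl ← ∈-map⁻ (x ,_) p′ =
  All.lookup x∉ (proj₂ (∈-pairsOf⁻ xs q′)) refl
... | inj₂ p′ | inj₁ q′ with _ , _ , refl ← ∈-map⁻ (x ,_) q′ =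
  All.lookup x∉ (proj₂ (∈-pairsOf⁻ xs p′)) refl
... | inj₁ p′ | inj₁ q′ with _ , b∈ , refl ← ∈-map⁻ (x ,_) p′ | _ , _ , refl ← ∈-map⁻ (x ,_) q′ =
  All.lookup x∉ b∈ refl

pairsOf-unique : ∀ {xs : List A} → Unique xs → Unique (pairsOf xs)
pairsOf-unique []         = []
pairsOf-unique {xs = x ∷ xs} (x∉ ∷ xs!) =
  Unique.++⁺ (Unique.map⁺ ,-injectiveʳ xs!) (pairsOf-unique xs!) λ (p , q) → disjoint p q
  where
  disjoint : ∀ {ab} → ab ∈ map (x ,_) xs → ab ∉ pairsOf xs
  disjoint p q with _ , _ , refl ← ∈-map⁻ (x ,_) p = All.lookup x∉ (proj₁ (∈-pairsOf⁻ xs q)) refl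

length-filter-map : {B : Set} {P : Pred B 0ℓ} (P? : Decidable P) (g : A → B) (xs : List A) →
                    length (filter P? (map g xs)) ≡ length (filter (P? ∘ g) xs)
length-filter-map P? g []       = refl
length-filter-map P? g (x ∷ xs) with does (P? (g x))
... | true  = cong suc (length-filter-map P? g xs)
... | false = length-filter-map P? g xs

length-filterᵇ-filterᵇ : (f g : A → Bool) (xs : List A) →
                         length (filterᵇ g (filterᵇ f xs)) ≡ length (filterᵇ (λ x → f x ∧ g x) xs)
length-filterᵇ-filterᵇ f g []       = refl
length-filterᵇ-filterᵇ f g (x ∷ xs) with f x
... | false = length-filterᵇ-filterᵇ f g xs
... | true with g x
...   | true  = cong suc (length-filterᵇ-filterᵇ f g xs)
...   | false = length-filterᵇ-filterᵇ f g xs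

length-filter-¬ : {P : Pred A 0ℓ} (P? : Decidable P) (xs : List A) →
                  length (filter P? xs) + length (filter (¬? ∘ P?) xs) ≡ length xs
length-filter-¬ P? []       = refl
length-filter-¬ P? (x ∷ xs) with does (P? x)
... | true  = cong suc (length-filter-¬ P? xs)
... | false = trans (ℕ.+-suc (length (filter P? xs)) _) (cong suc (length-filter-¬ P? xs))

length-filter-cartesianProduct :
  {B : Set} {R : Pred (A × B) 0ℓ} {d : ℕ} (R? : Decidable R) (xs : List A) (ys : List B) →
  (∀ {x} → x ∈ xs → length (filter (λ y → R? (x , y)) ys) ≡ d) →
  length (filter R? (cartesianProduct xs ys)) ≡ length xs * d
length-filter-cartesianProduct R? []       ys rows = refl
length-filter-cartesianProduct {d = d} R? (x ∷ xs) ys rows = begin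
  length (filter R? (map (x ,_) ys ++ rest))
    ≡⟨ cong length (filter-++ R? (map (x ,_) ys) rest) ⟩
  length (filter R? (map (x ,_) ys) ++ filter R? rest)
    ≡⟨ length-++ (filter R? (map (x ,_) ys)) ⟩
  length (filter R? (map (x ,_) ys)) + length (filter R? rest)
    ≡⟨ cong₂ _+_ (trans (length-filter-map R? (x ,_) ys) (rows (here refl)))
                 (length-filter-cartesianProduct R? xs ys (rows ∘ there)) ⟩
  d + length xs * d ∎
  where
  open ≡-Reasoning
  rest = cartesianProduct xs ys

-- Distances in a bipartite graph with a hub

module _ (G : SimpleGraph) where

  open SimpleGraph G

  module _ {A : Set} {code : V → A} (code-cong : ∀ {u v} → u ≈ᵥ v → code u ≡ code v)
           (code-injective : ∀ {u v} → code u ≡ code v → u ≈ᵥ v) where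

    -- An unordered pair can be presented in two orders. Since `ps` never contains both orders, the
    -- listed one is a key that does not depend on the presentation.
    pairsAtDistance-size :
      ∀ {P : Pred V 0ℓ} {h} {ps : List (A × A)} → Unique ps →
      (∀ {a b} → (a , b) ∈ ps → (b , a) ∉ ps) →
      (∀ {u v} → P u → P v → Distance G u v h → (code u , code v) ∈ ps ⊎ (code v , code u) ∈ ps) →
      (∀ {a b} → (a , b) ∈ ps → ∃[ u ] ∃[ v ] P u × P v × Distance G u v h × code u ≡ a × code v ≡ b) →
      PairsAtDistance G P h HasSize length ps
    pairsAtDistance-size {P} {h} {ps} ps! asym listed preimage =
      hasSize (PairsAtDistance G P h) ps! key key-cong key-injective key∈ key-preimage
      where
      Listed : Rel A 0ℓ
      Listed a b = (a , b) ∈ ps ⊎ (b , a) ∈ ps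

      orient : ∀ {a b} → Listed a b → A × A
      orient {a} {b} (inj₁ _) = a , b
      orient {a} {b} (inj₂ _) = b , a

      orient-∈ : ∀ {a b} (s : Listed a b) → orient s ∈ ps
      orient-∈ (inj₁ p) = p
      orient-∈ (inj₂ p) = p

      orient-irrelevant : ∀ {a b} (s s′ : Listed a b) → orient s ≡ orient s′
      orient-irrelevant (inj₁ _) (inj₁ _) = refl
      orient-irrelevant (inj₂ _) (inj₂ _) = refl
      orient-irrelevant (inj₁ p) (inj₂ q) = contradiction q (asym p)
      orient-irrelevant (inj₂ p) (inj₁ q) = contradiction p (asym q)

      orient-swap : ∀ {a b} (s : Listed a b) → orient (Sum.swap s) ≡ orient s
      orient-swap (inj₁ _) = refl
      orient-swap (inj₂ _) = refl

      orient-injective : ∀ {a b c d} (s : Listed a b) (s′ : Listed c d) → orient s ≡ orient s′ →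
                         (a ≡ c × b ≡ d) ⊎ (a ≡ d × b ≡ c)
      orient-injective (inj₁ _) (inj₁ _) refl = inj₁ (refl , refl)
      orient-injective (inj₁ _) (inj₂ _) refl = inj₂ (refl , refl)
      orient-injective (inj₂ _) (inj₁ _) refl = inj₂ (refl , refl)
      orient-injective (inj₂ _) (inj₂ _) refl = inj₁ (refl , refl)

      open Setoid (PairsAtDistance G P h) using (Carrier) renaming (_≈_ to _≈ₚ_)

      listing : ((u , v , _) : Carrier) → Listed (code u) (code v)
      listing (_ , _ , pu , pv , d) = listed pu pv d

      key : Carrier → A × A
      key p = orient (listing p)

      orient-cong : ∀ {a b c d} (s : Listed a b) (s′ : Listed c d) →
                    (a ≡ c × b ≡ d) ⊎ (a ≡ d × b ≡ c) → orient s ≡ orient s′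
      orient-cong s s′ (inj₁ (refl , refl)) = orient-irrelevant s s′
      orient-cong s s′ (inj₂ (refl , refl)) = trans (orient-irrelevant s (Sum.swap s′)) (orient-swap s′)

      key-cong : ∀ {p q} → p ≈ₚ q → key p ≡ key q
      key-cong {p} {q} = orient-cong (listing p) (listing q) ∘
        Sum.map (λ (e , f) → code-cong e , code-cong f) (λ (e , f) → code-cong e , code-cong f)

      key-injective : ∀ {p q} → key p ≡ key q → p ≈ₚ q
      key-injective {p} {q} = Sum.map (λ (e , f) → code-injective e , code-injective f)
                                      (λ (e , f) → code-injective e , code-injective f)
        ∘ orient-injective (listing p) (listing q)

      key∈ : ∀ p → key p ∈ ps
      key∈ p = orient-∈ (listing p)

      key-preimage : ∀ {ab} → ab ∈ ps → ∃[ p ] key p ≡ ab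
      key-preimage ab∈ with u , v , pu , pv , d , refl , refl ← preimage ab∈ =
        (u , v , pu , pv , d) , orient-irrelevant (listed pu pv d) (inj₁ ab∈)

  -- `true` marks the side that is joined entirely to the hub; the vertices coloured `false` are
  -- only known to have some neighbour.
  module HubbedBipartite
    (colour : V → Bool) (colour-cong : ∀ {u v} → u ≈ᵥ v → colour u ≡ colour v)
    (colour-adj : ∀ {u v} → Adj u v → colour v ≡ not (colour u))
    (hub : V) (hub-adj : ∀ {u} → colour u ≡ true → Adj u hub)
    (neighbour : ∀ {v} → colour v ≡ false → ∃[ u ] Adj v u)
    where

    open Setoid vertices using () renaming (refl to ≈ᵥ-refl)

    flips : ℕ → Bool → Bool
    flips zero    c = c
    flips (suc m) c = flips m (not c)

    colour-walk : ∀ {m u v} → Walk G m u v → colour v ≡ flips m (colour u)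
    colour-walk (nil u≈v) = sym (colour-cong u≈v)
    colour-walk (cons {h} a w) = trans (colour-walk w) (cong (flips h) (colour-adj a))

    walk-1⁻ : ∀ {u v} → Walk G 1 u v → Adj u v
    walk-1⁻ (cons a (nil e)) = proj₁ adj-resp e a

    walk-2⁻ : ∀ {u v} → Walk G 2 u v → ∃[ w ] Adj u w × Adj w v
    walk-2⁻ (cons a w) = _ , a , walk-1⁻ w

    walk-0⁻ : ∀ {u v} → Walk G 0 u v → u ≈ᵥ v
    walk-0⁻ (nil e) = e

    walk-1⁺ : ∀ {u v} → Adj u v → Walk G 1 u v
    walk-1⁺ a = cons a (nil ≈ᵥ-refl)

    Meet : Rel V 0ℓ
    Meet u v = ∃[ w ] Adj u w × Adj w v

    distance-1⁺ : ∀ {u v} → Adj u v → Distance G u v 1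
    distance-1⁺ a = walk-1⁺ a , λ { 0 _ w → adj-irr (walk-0⁻ w) a ; (suc m) (s≤s ()) }

    colour-clash : ∀ {b c} {X : Set} → b ≡ c → b ≡ not c → X
    colour-clash {true}  refl ()
    colour-clash {false} refl ()

    distance-2⁺ : ∀ {u v} → colour u ≡ colour v → ¬ u ≈ᵥ v → Meet u v → Distance G u v 2
    distance-2⁺ e u≉v (_ , a , b) = cons a (walk-1⁺ b) , λ where
      0 _ w → u≉v (walk-0⁻ w)
      1 _ w → colour-clash (sym e) (colour-walk w)
      (suc (suc m)) (s≤s (s≤s ()))

    distance-3⁺ : ∀ {u v} → colour u ≡ true → colour v ≡ false → ¬ Adj u v → Distance G u v 3
    distance-3⁺ cu cv ¬a =
      let _ , b = neighbour cv
          c = trans (colour-adj b) (cong not cv)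
      -- The route is `u`, hub, a neighbour of `v`, `v`. Even lengths are excluded by colour, length
      -- 1 by non-adjacency.
      in cons (hub-adj cu) (cons (adj-sym (hub-adj c)) (walk-1⁺ (adj-sym b))) , λ where
      0 _ w → colour-clash (trans (colour-walk w) cu) cv
      1 _ w → ¬a (walk-1⁻ w)
      2 _ w → colour-clash (trans (colour-walk w) (cong (not ∘ not) cu)) cv
      (suc (suc (suc m))) (s≤s (s≤s (s≤s ())))

    distance-4⁺ : ∀ {u v} → colour u ≡ false → colour v ≡ false → ¬ u ≈ᵥ v → ¬ Meet u v → Distance G u v 4
    distance-4⁺ cu cv u≉v ¬m =
      let _ , a = neighbour cu
          _ , b = neighbour cv
          ca = trans (colour-adj a) (cong not cu)
          cb = trans (colour-adj b) (cong not cv)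
      -- The route is `u`, a neighbour of `u`, hub, a neighbour of `v`, `v`. Odd lengths are
      -- excluded by colour, length 2 by the lack of a common neighbour.
      in cons a (cons (hub-adj ca) (cons (adj-sym (hub-adj cb)) (walk-1⁺ (adj-sym b)))) , λ where
      0 _ w → u≉v (walk-0⁻ w)
      1 _ w → colour-clash (trans (colour-walk w) (cong not cu)) cv
      2 _ w → ¬m (walk-2⁻ w)
      3 _ w → colour-clash (trans (colour-walk w) (cong (not ∘ not ∘ not) cu)) cv
      (suc (suc (suc (suc m)))) (s≤s (s≤s (s≤s (s≤s ()))))

    -- The hypothesis expresses that `m` is odd: `m` negations amount to one.
    colour-odd : ∀ {m u v} → flips m (colour u) ≡ not (colour u) → Walk G m u v →
                 (colour u ≡ true × colour v ≡ false) ⊎ (colour u ≡ false × colour v ≡ true)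
    colour-odd {u = u} odd w with colour u | trans (colour-walk w) odd
    ... | true  | e = inj₁ (refl , e)
    ... | false | e = inj₂ (refl , e)

    -- Counting is done on codes, because filtering a finite list needs a decision and `J?` decides
    -- adjacency there. `L₁` and `L₂` enumerate the codes of the two sides.
    module Counting
      {A : Set} {code : V → A} (code-cong : ∀ {u v} → u ≈ᵥ v → code u ≡ code v)
      (code-injective : ∀ {u v} → code u ≡ code v → u ≈ᵥ v)
      {L₁ L₂ : List A} (L₁! : Unique L₁) (L₂! : Unique L₂)
      (code∈L₁ : ∀ {u} → colour u ≡ true → code u ∈ L₁)
      (code∈L₂ : ∀ {u} → colour u ≡ false → code u ∈ L₂)
      (vertex₁ : ∀ {c} → c ∈ L₁ → ∃[ u ] colour u ≡ true × code u ≡ c)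
      (vertex₂ : ∀ {c} → c ∈ L₂ → ∃[ u ] colour u ≡ false × code u ≡ c)
      {J : Pred (A × A) 0ℓ} (J? : Decidable J)
      (J⇔Adj : ∀ {u v} → colour u ≡ true → colour v ≡ false → J (code u , code v) ⇔ Adj u v)
      {D : ℕ} (degree : ∀ {a} → a ∈ L₁ → length (filter (λ b → J? (a , b)) L₂) ≡ D)
      where

      L₁∩L₂=∅ : ∀ {c} → c ∈ L₁ → c ∉ L₂
      L₁∩L₂=∅ c∈₁ c∈₂ with u , cu , refl ← vertex₁ c∈₁ | v , cv , e ← vertex₂ c∈₂ =
        colour-clash (trans (colour-cong (code-injective (sym e))) cv) cu

      -- Listed pairs have their `L₁` end first, so disjointness of `L₁` and `L₂` rules out the
      -- reversed pair, and the length is a sum over rows. A pair may also be presented with its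
      -- other end first, which is why `separated` accepts a distance in either direction.
      cross-size : ∀ {h d} {F : Pred (A × A) 0ℓ} (F? : Decidable F) →
        (∀ {u v} → colour u ≡ true → colour v ≡ false → F (code u , code v) → Distance G u v h) →
        (∀ {u v} → colour u ≡ true → colour v ≡ false → Distance G u v h ⊎ Distance G v u h →
          F (code u , code v)) →
        (∀ {u v} → Distance G u v h → (colour u ≡ true × colour v ≡ false) ⊎ (colour u ≡ false × colour v ≡ true)) →
        (∀ {a} → a ∈ L₁ → length (filter (λ b → F? (a , b)) L₂) ≡ d) →
        PairsAtDistance G U h HasSize length L₁ * d
      cross-size {h} {F = F} F? distant separated bichromatic rows =
        subst (PairsAtDistance G U h HasSize_) (length-filter-cartesianProduct F? L₁ L₂ rows)
          (pairsAtDistance-size code-cong code-injective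
            (Unique.filter⁺ F? (Unique.cartesianProduct⁺ L₁! L₂!))
            (λ p q → L₁∩L₂=∅ (proj₁ (unfilter p)) (proj₁ (proj₂ (unfilter q))))
            (λ _ _ d → listed (bichromatic d) d)
            λ p → let a∈ , b∈ , f = unfilter p in edge a∈ b∈ f)
        where
        edges = filter F? (cartesianProduct L₁ L₂)
        unfilter : ∀ {a b} → (a , b) ∈ edges → a ∈ L₁ × b ∈ L₂ × F (a , b)
        unfilter p = let q , f = ∈-filter⁻ F? {xs = cartesianProduct L₁ L₂} p
                         a∈ , b∈ = ∈-cartesianProduct⁻ L₁ L₂ q
                     in a∈ , b∈ , f
        listed : ∀ {u v} → (colour u ≡ true × colour v ≡ false) ⊎ (colour u ≡ false × colour v ≡ true) →
                 Distance G u v h → (code u , code v) ∈ edges ⊎ (code v , code u) ∈ edges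
        listed (inj₁ (cu , cv)) d =
          inj₁ (∈-filter⁺ F? (∈-cartesianProduct⁺ (code∈L₁ cu) (code∈L₂ cv)) (separated cu cv (inj₁ d)))
        listed (inj₂ (cu , cv)) d =
          inj₂ (∈-filter⁺ F? (∈-cartesianProduct⁺ (code∈L₁ cv) (code∈L₂ cu)) (separated cv cu (inj₂ d)))
        edge : ∀ {a b} → a ∈ L₁ → b ∈ L₂ → F (a , b) →
               ∃[ u ] ∃[ v ] U u × U v × Distance G u v h × code u ≡ a × code v ≡ b
        edge a∈ b∈ f with u , cu , refl ← vertex₁ a∈ | v , cv , refl ← vertex₂ b∈ =
          u , v , _ , _ , distant cu cv f , refl , refl

      size-1 : PairsAtDistance G U 1 HasSize length L₁ * D
      size-1 = cross-size J?
        (λ cu cv j → distance-1⁺ (Equivalence.to (J⇔Adj cu cv) j))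
        (λ { cu cv (inj₁ (w , _)) → Equivalence.from (J⇔Adj cu cv) (walk-1⁻ w)
           ; cu cv (inj₂ (w , _)) → Equivalence.from (J⇔Adj cu cv) (adj-sym (walk-1⁻ w)) })
        (λ (w , _) → colour-odd refl w)
        degree

      -- Vertices of different colours are at distance 3 precisely when they are not adjacent, so
      -- each row is the complement of a neighbourhood in `L₂`.
      size-3 : PairsAtDistance G U 3 HasSize length L₁ * (length L₂ ∸ D)
      size-3 = cross-size (¬? ∘ J?)
        (λ cu cv ¬j → distance-3⁺ cu cv (¬j ∘ Equivalence.from (J⇔Adj cu cv)))
        (λ { cu cv (inj₁ (_ , min)) j →
               min 1 (s≤s (s≤s z≤n)) (walk-1⁺ (Equivalence.to (J⇔Adj cu cv) j))
           ; cu cv (inj₂ (_ , min)) j →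
               min 1 (s≤s (s≤s z≤n)) (walk-1⁺ (adj-sym (Equivalence.to (J⇔Adj cu cv) j))) })
        (λ {u} (w , _) → colour-odd (cong not (not-involutive (colour u))) w)
        λ {a} a∈ → trans (sym (ℕ.m+n∸m≡n (length (filter (λ b → J? (a , b)) L₂)) _))
          (cong₂ _∸_ (length-filter-¬ (λ b → J? (a , b)) L₂) (degree a∈))

      module _ {P : Pred V 0ℓ} {c₀ : Bool} (P⇒colour : ∀ {u} → P u → colour u ≡ c₀)
               (colour⇒P : ∀ {u} → colour u ≡ c₀ → P u)
               {L : List A} (L! : Unique L) (code∈L : ∀ {u} → colour u ≡ c₀ → code u ∈ L)
               (vertex : ∀ {c} → c ∈ L → ∃[ u ] colour u ≡ c₀ × code u ≡ c) where

        -- The order inside a listed pair is dictated by `L`, not by the presentation of the pair of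
        -- vertices; hence `separated` must supply `Q` for both orders.
        within-size : ∀ {h} {Q : Pred (A × A) 0ℓ} (Q? : Decidable Q) →
          (∀ {u v} → colour u ≡ c₀ → colour v ≡ c₀ → ¬ u ≈ᵥ v → Q (code u , code v) → Distance G u v h) →
          (∀ {u v} → Distance G u v h → ¬ u ≈ᵥ v) →
          (∀ {u v} → colour u ≡ c₀ → colour v ≡ c₀ → Distance G u v h →
            Q (code u , code v) × Q (code v , code u)) →
          PairsAtDistance G P h HasSize length (filter Q? (pairsOf L))
        within-size {h} {Q} Q? distant distinct separated =
          pairsAtDistance-size code-cong code-injective
            (Unique.filter⁺ Q? (pairsOf-unique L!))
            (λ p q → pairsOf-asym L! (unfilter p) (unfilter q))
            (λ pu pv d → let cu = P⇒colour pu ; cv = P⇒colour pv ; q , q′ = separated cu cv d in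
              Sum.map (λ p → ∈-filter⁺ Q? p q) (λ p → ∈-filter⁺ Q? p q′)
                (∈-pairsOf⁺ (code∈L cu) (code∈L cv) (distinct d ∘ code-injective)))
            λ p → pair (unfilter p) (proj₂ (∈-filter⁻ Q? {xs = pairsOf L} p))
          where
          unfilter : ∀ {ab} → ab ∈ filter Q? (pairsOf L) → ab ∈ pairsOf L
          unfilter p = proj₁ (∈-filter⁻ Q? {xs = pairsOf L} p)
          pair : ∀ {a b} → (a , b) ∈ pairsOf L → Q (a , b) →
                 ∃[ u ] ∃[ v ] P u × P v × Distance G u v h × code u ≡ a × code v ≡ b
          pair p q with u , cu , refl ← vertex (proj₁ (∈-pairsOf⁻ L p))
                      | v , cv , refl ← vertex (proj₂ (∈-pairsOf⁻ L p)) =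
            u , v , colour⇒P cu , colour⇒P cv , distant cu cv u≉v q , refl , refl
            where
            u≉v : ¬ u ≈ᵥ v
            -- Equal codes would make the pair its own reverse, so both orders would be listed.
            u≉v e = pairsOf-asym L! p
              (subst₂ (λ a b → (a , b) ∈ pairsOf L) (code-cong e) (sym (code-cong e)) p)

      positive-distance : ∀ {h u v} → Distance G u v (suc h) → ¬ u ≈ᵥ v
      positive-distance (_ , min) u≈v = min 0 (s≤s z≤n) (nil u≈v)

      size-2₁ : ∀ {P : Pred V 0ℓ} → (∀ {u} → P u → colour u ≡ true) → (∀ {u} → colour u ≡ true → P u) →
                PairsAtDistance G P 2 HasSize length L₁ C 2
      size-2₁ {P} to from =
        subst (PairsAtDistance G P 2 HasSize_)
          (trans (cong length (filter-all U? (All.universal-U (pairsOf L₁)))) (length-pairsOf L₁))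
          (within-size to from L₁! code∈L₁ vertex₁ U?
            (λ cu cv u≉v _ → distance-2⁺ (trans cu (sym cv)) u≉v (hub , hub-adj cu , adj-sym (hub-adj cv)))
            positive-distance (λ _ _ _ → _ , _))

      Meetᶜ : Pred (A × A) 0ℓ
      Meetᶜ (a , b) = Any (λ c → J (c , a) × J (c , b)) L₁

      meet? : Decidable Meetᶜ
      meet? (a , b) = any? (λ c → J? (c , a) ×-dec J? (c , b)) L₁

      Meet⇒Meetᶜ : ∀ {u v} → colour u ≡ false → colour v ≡ false → Meet u v → Meetᶜ (code u , code v)
      Meet⇒Meetᶜ cu cv (w , a , b) =
        lose (code∈L₁ cw) (Equivalence.from (J⇔Adj cw cu) (adj-sym a) , Equivalence.from (J⇔Adj cw cv) b)
        where cw = trans (colour-adj a) (cong not cu)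

      Meetᶜ⇒Meet : ∀ {u v} → colour u ≡ false → colour v ≡ false → Meetᶜ (code u , code v) → Meet u v
      Meetᶜ⇒Meet cu cv m with c , c∈ , s , t ← find m with w , cw , refl ← vertex₁ c∈ =
        w , adj-sym (Equivalence.to (J⇔Adj cw cu) s) , Equivalence.to (J⇔Adj cw cv) t

      meet-sym : ∀ {u v} → Meet u v → Meet v u
      meet-sym (w , a , b) = w , adj-sym b , adj-sym a

      -- Distinct vertices of the second side are at distance 2 or 4 according to whether they have
      -- a common neighbour. This is decided by searching `L₁`, and the decision splits `pairsOf L₂`
      -- into two filters.
      size-2-4₂ : ∀ {P : Pred V 0ℓ} → (∀ {u} → P u → colour u ≡ false) → (∀ {u} → colour u ≡ false → P u) →
        ∃[ d₂ ] ∃[ d₄ ] PairsAtDistance G P 2 HasSize d₂ × PairsAtDistance G P 4 HasSize d₄ ×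
          d₂ + d₄ ≡ length L₂ C 2
      size-2-4₂ to from = _ , _ ,
        within-size to from L₂! code∈L₂ vertex₂ meet?
          (λ cu cv u≉v m → distance-2⁺ (trans cu (sym cv)) u≉v (Meetᶜ⇒Meet cu cv m))
          positive-distance
          (λ cu cv (w , _) → let m = walk-2⁻ w in Meet⇒Meetᶜ cu cv m , Meet⇒Meetᶜ cv cu (meet-sym m)) ,
        within-size to from L₂! code∈L₂ vertex₂ (¬? ∘ meet?)
          (λ cu cv u≉v ¬m → distance-4⁺ cu cv u≉v (¬m ∘ Meet⇒Meetᶜ cu cv))
          positive-distance
          (λ cu cv (_ , min) → let ¬m = λ (_ , a , b) → min 2 (s≤s (s≤s (s≤s z≤n))) (cons a (walk-1⁺ b)) in
            ¬m ∘ Meetᶜ⇒Meet cu cv , ¬m ∘ meet-sym ∘ Meetᶜ⇒Meet cv cu) ,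
        trans (length-filter-¬ meet? (pairsOf L₂)) (length-pairsOf L₂)

-- Counting sign vectors


data Trit : Set where
  𝟘 ⊕ ⊖ : Trit

-- A subset of {± x₁ , … , ± xₙ} with distinct absolute values, as its vector of signs.
Signed : ℕ → Set
Signed = Vec Trit

nonzero : Trit → Bool
nonzero 𝟘 = outside
nonzero ⊕ = inside
nonzero ⊖ = inside

supp : Signed n → Subset n
supp = Vec.map nonzero

positive : Signed n → Bool
positive []      = true
positive (𝟘 ∷ t) = positive t
positive (⊕ ∷ t) = positive t
positive (⊖ ∷ t) = false

null : Signed n → Bool
null []      = true
null (𝟘 ∷ t) = null t
null (⊕ ∷ t) = false
null (⊖ ∷ t) = false

-- The last nonzero entry is ⊕.
topPositive : Signed n → Bool
topPositive []      = false
topPositive (𝟘 ∷ t) = topPositive t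
topPositive (⊕ ∷ t) = topPositive t ∨ null t
topPositive (⊖ ∷ t) = topPositive t

isV₁ : ℕ → Signed n → Bool
isV₁ k t = positive t ∧ (∣ supp t ∣ ≡ᵇ k)

isV₂ : ℕ → Signed n → Bool
isV₂ k t = topPositive t ∧ not (isV₁ k t)

nested : Subset n → Subset n → Bool
nested p q = does (p ⊆? q) ∨ does (q ⊆? p)

bit : Bool → ℕ
bit true  = 1
bit false = 0

-- The number of sign vectors passing the test, defined by recursion on the first coordinate so that
-- counts split by computation; `length-filterᵇ-signed` relates it to lists.
# : (Signed n → Bool) → ℕ
# {zero}  f = bit (f [])
# {suc n} f = # (f ∘ (𝟘 ∷_)) + (# (f ∘ (⊕ ∷_)) + # (f ∘ (⊖ ∷_)))

#-cong : {f g : Signed n → Bool} → f ≗ g → # f ≡ # g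
#-cong {zero}  f≗g = cong bit (f≗g [])
#-cong {suc n} f≗g = cong₂ _+_ (#-cong (f≗g ∘ (𝟘 ∷_)))
  (cong₂ _+_ (#-cong (f≗g ∘ (⊕ ∷_))) (#-cong (f≗g ∘ (⊖ ∷_))))

-- Two terms on each side is the shape of inclusion-exclusion. A disjoint splitting of one test into
-- two has the same shape once padded with the constantly false test.
#-+ : {f g h e : Signed n → Bool} → (∀ t → bit (f t) + bit (g t) ≡ bit (h t) + bit (e t)) →
      # f + # g ≡ # h + # e
#-+ {zero}  eq = eq []
#-+ {suc n} {f} {g} {h} {e} eq = begin
  # f + # g
    ≡⟨ interchange (# (f ∘ (𝟘 ∷_))) (# (f ∘ (⊕ ∷_))) (# (f ∘ (⊖ ∷_))) _ (# (g ∘ (⊕ ∷_))) (# (g ∘ (⊖ ∷_))) ⟩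
  (# (f ∘ (𝟘 ∷_)) + # (g ∘ (𝟘 ∷_))) +
    ((# (f ∘ (⊕ ∷_)) + # (g ∘ (⊕ ∷_))) + (# (f ∘ (⊖ ∷_)) + # (g ∘ (⊖ ∷_))))
    ≡⟨ cong₂ _+_ (#-+ (eq ∘ (𝟘 ∷_))) (cong₂ _+_ (#-+ (eq ∘ (⊕ ∷_))) (#-+ (eq ∘ (⊖ ∷_)))) ⟩
  (# (h ∘ (𝟘 ∷_)) + # (e ∘ (𝟘 ∷_))) +
    ((# (h ∘ (⊕ ∷_)) + # (e ∘ (⊕ ∷_))) + (# (h ∘ (⊖ ∷_)) + # (e ∘ (⊖ ∷_))))
    ≡⟨ interchange (# (h ∘ (𝟘 ∷_))) (# (h ∘ (⊕ ∷_))) (# (h ∘ (⊖ ∷_))) _ (# (e ∘ (⊕ ∷_))) (# (e ∘ (⊖ ∷_))) ⟨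
  # h + # e ∎
  where
  open ≡-Reasoning
  interchange : ∀ a b c a′ b′ c′ → a + (b + c) + (a′ + (b′ + c′)) ≡ (a + a′) + ((b + b′) + (c + c′))
  interchange = solve-∀

#-none : {f : Signed n → Bool} → (∀ t → ¬ T (f t)) → # f ≡ 0
#-none {zero} {f} ¬f with f [] | ¬f []
... | true  | ¬⊤ = contradiction tt ¬⊤
... | false | _  = refl
#-none {suc n} {f} ¬f
  rewrite #-none (¬f ∘ (𝟘 ∷_)) | #-none (¬f ∘ (⊕ ∷_)) | #-none (¬f ∘ (⊖ ∷_)) = refl

#-false : # {n} (λ _ → false) ≡ 0
#-false {n} = #-none {n} λ _ → id

#-unique : {f : Signed n → Bool} (s : Signed n) → T (f s) → (∀ t → T (f t) → t ≡ s) → # f ≡ 1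
#-unique {f = f} [] fs _ with f []
... | true = refl
#-unique {f = f} (a ∷ s) fs only = split a fs only
  where
  same : ∀ a → T (f (a ∷ s)) → (∀ t → T (f t) → t ≡ a ∷ s) → # (f ∘ (a ∷_)) ≡ 1
  same a fs only = #-unique s fs λ t ft → proj₂ (∷-injective (only (a ∷ t) ft))
  other : ∀ {a} b → a ≢ b → (∀ t → T (f t) → t ≡ a ∷ s) → # (f ∘ (b ∷_)) ≡ 0
  other b a≢b only = #-none λ t ft → a≢b (sym (proj₁ (∷-injective (only (b ∷ t) ft))))
  split : ∀ a → T (f (a ∷ s)) → (∀ t → T (f t) → t ≡ a ∷ s) → # f ≡ 1
  split 𝟘 fs only rewrite same 𝟘 fs only | other ⊕ (λ ()) only | other ⊖ (λ ()) only = refl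
  split ⊕ fs only rewrite same ⊕ fs only | other 𝟘 (λ ()) only | other ⊖ (λ ()) only = refl
  split ⊖ fs only rewrite same ⊖ fs only | other 𝟘 (λ ()) only | other ⊕ (λ ()) only = refl

signed : ∀ n → List (Signed n)
signed zero    = [] ∷ []
signed (suc n) = cartesianProductWith _∷_ (𝟘 ∷ ⊕ ∷ ⊖ ∷ []) (signed n)

∈-signed : (t : Signed n) → t ∈ signed n
∈-signed []      = here refl
∈-signed (a ∷ t) = ∈-cartesianProductWith⁺ _∷_ (∈-trits a) (∈-signed t)
  where
  ∈-trits : ∀ a → a ∈ 𝟘 ∷ ⊕ ∷ ⊖ ∷ []
  ∈-trits 𝟘 = here refl
  ∈-trits ⊕ = there (here refl)
  ∈-trits ⊖ = there (there (here refl))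

signed-unique : ∀ n → Unique (signed n)
signed-unique zero    = [] ∷ []
signed-unique (suc n) = Unique.cartesianProductWith⁺ _∷_ ∷-injective
  (((λ ()) ∷ (λ ()) ∷ []) ∷ ((λ ()) ∷ []) ∷ [] ∷ []) (signed-unique n)

length-filterᵇ-signed : ∀ n (f : Signed n → Bool) → length (filterᵇ f (signed n)) ≡ # f
length-filterᵇ-signed zero f with f []
... | true  = refl
... | false = refl
length-filterᵇ-signed (suc n) f =
  trans (block 𝟘 _) (cong (# (f ∘ (𝟘 ∷_)) +_)
    (trans (block ⊕ _) (cong (# (f ∘ (⊕ ∷_)) +_)
      (trans (block ⊖ []) (ℕ.+-identityʳ _)))))
  where
  block : ∀ a ts → length (filterᵇ f (map (a ∷_) (signed n) ++ ts)) ≡ # (f ∘ (a ∷_)) + length (filterᵇ f ts)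
  block a ts = begin
    length (filterᵇ f (map (a ∷_) (signed n) ++ ts))
      ≡⟨ cong length (filter-++ (T? ∘ f) (map (a ∷_) (signed n)) ts) ⟩
    length (filterᵇ f (map (a ∷_) (signed n)) ++ filterᵇ f ts)
      ≡⟨ length-++ (filterᵇ f (map (a ∷_) (signed n))) ⟩
    length (filterᵇ f (map (a ∷_) (signed n))) + length (filterᵇ f ts)
      ≡⟨ cong (_+ length (filterᵇ f ts)) (trans (length-filter-map (T? ∘ f) (a ∷_) (signed n))
           (length-filterᵇ-signed n (f ∘ (a ∷_)))) ⟩
    # (f ∘ (a ∷_)) + length (filterᵇ f ts) ∎
    where open ≡-Reasoning

null⇒supp≡⊥ : (t : Signed n) → T (null t) → supp t ≡ ⊥
null⇒supp≡⊥ []      _ = refl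
null⇒supp≡⊥ (𝟘 ∷ t) z = cong (outside ∷_) (null⇒supp≡⊥ t z)

topPositive⇒¬null : (t : Signed n) → T (topPositive t) → ¬ T (null t)
topPositive⇒¬null (𝟘 ∷ t) = topPositive⇒¬null t
topPositive⇒¬null (⊕ ∷ t) _ ()
topPositive⇒¬null (⊖ ∷ t) _ ()

positive⇒topPositive∨null : (t : Signed n) → T (positive t) → T (topPositive t ∨ null t)
positive⇒topPositive∨null []      _ = tt
positive⇒topPositive∨null (𝟘 ∷ t) p = positive⇒topPositive∨null t p
positive⇒topPositive∨null (⊕ ∷ t) p with topPositive t ∨ null t | positive⇒topPositive∨null t p
... | true | _ = tt

isV₁⁻ : ∀ {k} (t : Signed n) → T (isV₁ k t) → T (positive t) × ∣ supp t ∣ ≡ k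
isV₁⁻ t v = let p , w = Equivalence.to T-∧ v in p , ℕ.≡ᵇ⇒≡ _ _ w

isV₁⁺ : ∀ {k} (t : Signed n) → T (positive t) → ∣ supp t ∣ ≡ k → T (isV₁ k t)
isV₁⁺ t p w = Equivalence.from T-∧ (p , ℕ.≡⇒≡ᵇ _ _ w)

-- A vector without minus signs leads with `⊕` unless it is null; the size `suc k` excludes the null
-- vector.
isV₁⇒topPositive : ∀ {k} (t : Signed n) → T (isV₁ (suc k) t) → T (topPositive t)
isV₁⇒topPositive {n} t v with p , w ← isV₁⁻ t v
  with Equivalence.to (T-∨ {x = topPositive t}) (positive⇒topPositive∨null t p)
... | inj₁ top = top
... | inj₂ z with () ← trans (sym w) (trans (cong ∣_∣ (null⇒supp≡⊥ t z)) (∣⊥∣≡0 n))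

#-null : (Q : Subset n → Bool) → # (λ t → null t ∧ Q (supp t)) ≡ bit (Q ⊥)
#-null {zero}  Q = refl
#-null {suc n} Q
  rewrite #-null {n} (Q ∘ (outside ∷_)) | #-false {n} = ℕ.+-identityʳ _

-- The left side is the test met after a first entry `⊕`, which itself leads when nothing nonzero
-- follows. The two alternatives exclude each other, and the null vector is the only one of its
-- kind, with support `⊥`.
#-topPositive-⊕ : (Q : Subset n → Bool) →
  # (λ t → (topPositive t ∨ null t) ∧ Q (supp t)) ≡ # (λ t → topPositive t ∧ Q (supp t)) + bit (Q ⊥)
#-topPositive-⊕ {n} Q = begin
  # (λ t → (topPositive t ∨ null t) ∧ Q (supp t))
    ≡⟨ ℕ.+-identityʳ _ ⟨
  # (λ t → (topPositive t ∨ null t) ∧ Q (supp t)) + 0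
    ≡⟨ cong (# (λ t → (topPositive t ∨ null t) ∧ Q (supp t)) +_) (#-false {n}) ⟨
  # (λ t → (topPositive t ∨ null t) ∧ Q (supp t)) + # {n} (λ _ → false)
    ≡⟨ #-+ (λ t → disjoint (Q (supp t)) (topPositive⇒¬null t)) ⟩
  # (λ t → topPositive t ∧ Q (supp t)) + # (λ t → null t ∧ Q (supp t))
    ≡⟨ cong (# (λ t → topPositive t ∧ Q (supp t)) +_) (#-null Q) ⟩
  # (λ t → topPositive t ∧ Q (supp t)) + bit (Q ⊥) ∎
  where
  open ≡-Reasoning
  disjoint : ∀ {a b} q → (T a → ¬ T b) → bit ((a ∨ b) ∧ q) + 0 ≡ bit (a ∧ q) + bit (b ∧ q)
  disjoint {true}  {true}  q ¬ab = contradiction tt (¬ab tt)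
  disjoint {true}  {false} q ¬ab = refl
  disjoint {false} {b}     q ¬ab = ℕ.+-identityʳ _

-- Negating all signs exchanges the nonzero vectors with last nonzero entry ⊕ and those with ⊖.
2#-topPositive : (Q : Subset n → Bool) → 2 * # (λ t → topPositive t ∧ Q (supp t)) + bit (Q ⊥) ≡ # (Q ∘ supp)
2#-topPositive {zero}  Q = refl
2#-topPositive {suc n} Q = begin
  2 * (a + (# (λ t → (topPositive t ∨ null t) ∧ Q₁ (supp t)) + b)) + bit (Q₀ ⊥)
    ≡⟨ cong (λ r → 2 * (a + (r + b)) + bit (Q₀ ⊥)) (#-topPositive-⊕ Q₁) ⟩
  2 * (a + (b + bit (Q₁ ⊥) + b)) + bit (Q₀ ⊥)
    ≡⟨ regroup a b (bit (Q₀ ⊥)) (bit (Q₁ ⊥)) ⟩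
  (2 * a + bit (Q₀ ⊥)) + ((2 * b + bit (Q₁ ⊥)) + (2 * b + bit (Q₁ ⊥)))
    ≡⟨ cong₂ (λ r s → r + (s + s)) (2#-topPositive Q₀) (2#-topPositive Q₁) ⟩
  # (Q₀ ∘ supp) + (# (Q₁ ∘ supp) + # (Q₁ ∘ supp)) ∎
  where
  open ≡-Reasoning
  Q₀ Q₁ : Subset n → Bool
  Q₀ = Q ∘ (outside ∷_)
  Q₁ = Q ∘ (inside ∷_)
  a b : ℕ
  a = # (λ t → topPositive t ∧ Q₀ (supp t))
  b = # (λ t → topPositive t ∧ Q₁ (supp t))
  regroup : ∀ a b q₀ q₁ → 2 * (a + (b + q₁ + b)) + q₀ ≡ (2 * a + q₀) + ((2 * b + q₁) + (2 * b + q₁))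
  regroup = solve-∀

x+x+x≡3*x : ∀ x → x + (x + x) ≡ 3 * x
x+x+x≡3*x = solve-∀

#-all : # {n} (λ _ → true) ≡ 3 ^ n
#-all {zero}  = refl
#-all {suc n} rewrite #-all {n} = x+x+x≡3*x (3 ^ n)

-- The choices are independent: three signs at a coordinate in `p`, only `𝟘` elsewhere. The Boolean
-- `does` of an inclusion reduces coordinate by coordinate, so the recursion of `#` sees this
-- directly. In the next two counts the choices are two in `p` and three elsewhere, then two in `p`
-- and one elsewhere.
#-supp⊆ : (p : Subset n) → # (λ t → does (supp t ⊆? p)) ≡ 3 ^ ∣ p ∣
#-supp⊆ []                    = refl
#-supp⊆ {suc n} (outside ∷ p) rewrite #-false {n} = trans (ℕ.+-identityʳ _) (#-supp⊆ p)
#-supp⊆ (inside ∷ p)          rewrite #-supp⊆ p = x+x+x≡3*x (3 ^ ∣ p ∣)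

#-⊆supp : (p : Subset n) → # (λ t → does (p ⊆? supp t)) ≡ 2 ^ ∣ p ∣ * 3 ^ ∣ ∁ p ∣
#-⊆supp []                   = refl
#-⊆supp (outside ∷ p)        rewrite #-⊆supp p = regroup (2 ^ ∣ p ∣) (3 ^ ∣ ∁ p ∣)
  where
  regroup : ∀ x y → x * y + (x * y + x * y) ≡ x * (3 * y)
  regroup = solve-∀
#-⊆supp {suc n} (inside ∷ p) rewrite #-false {n} | #-⊆supp p = regroup (2 ^ ∣ p ∣) (3 ^ ∣ ∁ p ∣)
  where
  regroup : ∀ x y → x * y + x * y ≡ 2 * x * y
  regroup = solve-∀

#-supp≡ : (p : Subset n) → # (λ t → does (p ⊆? supp t) ∧ does (supp t ⊆? p)) ≡ 2 ^ ∣ p ∣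
#-supp≡ []            = refl
#-supp≡ {suc n} (outside ∷ p)
  rewrite #-cong {n} {λ t → does (p ⊆? supp t) ∧ false} {λ _ → false} (λ t → ∧-zeroʳ _) | #-false {n}
  = trans (ℕ.+-identityʳ _) (#-supp≡ p)
#-supp≡ {suc n} (inside ∷ p) rewrite #-false {n} | #-supp≡ p = cong (2 ^ ∣ p ∣ +_) (sym (ℕ.+-identityʳ _))

-- The sizes of V₁ and V₂, and the degree of a vertex of V₁

#-isV₁ : ∀ n k → # {n} (isV₁ k) ≡ n C k
#-isV₁ zero    zero    = refl
#-isV₁ zero    (suc k) = refl
#-isV₁ (suc n) zero
  rewrite #-isV₁ n zero | #-cong {n} {λ t → positive t ∧ false} {λ _ → false} (λ t → ∧-zeroʳ _) | #-false {n} = refl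
#-isV₁ (suc n) (suc k) rewrite #-isV₁ n k | #-isV₁ n (suc k) | #-false {n} = begin
  n C suc k + (n C k + 0) ≡⟨ cong (n C suc k +_) (ℕ.+-identityʳ _) ⟩
  n C suc k + n C k       ≡⟨ ℕ.+-comm (n C suc k) _ ⟩
  n C k + n C suc k       ≡⟨ nCk+nC[k+1]≡[n+1]C[k+1] n k ⟩
  suc n C suc k           ∎
  where open ≡-Reasoning

⊆∧∣∣≡⇒≡ : {p q : Subset n} → p ⊆ q → ∣ p ∣ ≡ ∣ q ∣ → p ≡ q
⊆∧∣∣≡⇒≡ {p = []}          {[]}          _   _  = refl
⊆∧∣∣≡⇒≡ {p = outside ∷ p} {outside ∷ q} p⊆q eq = cong (outside ∷_) (⊆∧∣∣≡⇒≡ (drop-∷-⊆ p⊆q) eq)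
⊆∧∣∣≡⇒≡ {p = inside ∷ p}  {inside ∷ q}  p⊆q eq = cong (inside ∷_) (⊆∧∣∣≡⇒≡ (drop-∷-⊆ p⊆q) (ℕ.suc-injective eq))
⊆∧∣∣≡⇒≡ {p = outside ∷ p} {inside ∷ q}  p⊆q eq =
  contradiction eq (ℕ.<⇒≢ (s≤s (p⊆q⇒∣p∣≤∣q∣ (drop-∷-⊆ p⊆q))))
⊆∧∣∣≡⇒≡ {p = inside ∷ p}  {outside ∷ q} p⊆q _ = contradiction (p⊆q Vec.here) λ ()

positive-supp-injective : {s t : Signed n} → T (positive s) → T (positive t) → supp s ≡ supp t → s ≡ t
positive-supp-injective {s = []}    {[]}    _  _  _  = refl
positive-supp-injective {s = 𝟘 ∷ s} {𝟘 ∷ t} ps pt eq =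
  cong (𝟘 ∷_) (positive-supp-injective ps pt (proj₂ (∷-injective eq)))
positive-supp-injective {s = ⊕ ∷ s} {⊕ ∷ t} ps pt eq =
  cong (⊕ ∷_) (positive-supp-injective ps pt (proj₂ (∷-injective eq)))
positive-supp-injective {s = 𝟘 ∷ s} {⊕ ∷ t} _  _  ()
positive-supp-injective {s = ⊕ ∷ s} {𝟘 ∷ t} _  _  ()

nested⁻ : {p q : Subset n} → T (nested p q) → p ⊆ q ⊎ q ⊆ p
nested⁻ {p = p} {q} t with p ⊆? q | q ⊆? p
... | yes p⊆q | _       = inj₁ p⊆q
... | no _    | yes q⊆p = inj₂ q⊆p

nested⁺ : {p q : Subset n} → p ⊆ q ⊎ q ⊆ p → T (nested p q)
nested⁺ {p = p} {q} s with p ⊆? q | q ⊆? p | s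
... | yes _ | _     | _        = tt
... | no _  | yes _ | _        = tt
... | no ¬s | no _  | inj₁ p⊆q = contradiction (λ {x} → p⊆q {x}) ¬s
... | no _  | no ¬s | inj₂ q⊆p = contradiction (λ {x} → q⊆p {x}) ¬s

-- Nested sets of equal size coincide, and a vector without minus signs is determined by its
-- support, so `s` alone is counted.
#-isV₁-nested : ∀ {k} (s : Signed n) → T (isV₁ k s) → # (λ t → isV₁ k t ∧ nested (supp s) (supp t)) ≡ 1
#-isV₁-nested {k = k} s s∈ = #-unique s
  (Equivalence.from T-∧ (s∈ , nested⁺ {p = supp s} (inj₁ ⊆-refl)))
  λ t h → let t∈ , c = Equivalence.to (T-∧ {x = isV₁ k t}) h
              ps , ws = isV₁⁻ s s∈
              pt , wt = isV₁⁻ t t∈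
          in positive-supp-injective pt ps (equal (trans ws (sym wt)) (nested⁻ {p = supp s} c))
  where
  equal : ∀ {p q : Subset n} → ∣ p ∣ ≡ ∣ q ∣ → p ⊆ q ⊎ q ⊆ p → q ≡ p
  equal w (inj₁ p⊆q) = sym (⊆∧∣∣≡⇒≡ p⊆q w)
  equal w (inj₂ q⊆p) = ⊆∧∣∣≡⇒≡ q⊆p (sym w)

-- V₁ lies inside the vectors that lead with `⊕`, and V₂ is its complement there. The sum form
-- avoids truncated subtraction.
#-isV₂∧ : ∀ {k} (Q : Signed n → Bool) →
  # (λ t → isV₂ (suc k) t ∧ Q t) + # (λ t → isV₁ (suc k) t ∧ Q t) ≡ # (λ t → topPositive t ∧ Q t)
#-isV₂∧ {n} {k} Q = trans (#-+ λ t → split (Q t) (isV₁⇒topPositive t))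
  (trans (cong (# (λ t → topPositive t ∧ Q t) +_) (#-false {n})) (ℕ.+-identityʳ _))
  where
  split : ∀ {v a} q → (T v → T a) → bit ((a ∧ not v) ∧ q) + bit (v ∧ q) ≡ bit (a ∧ q) + 0
  split {true}  {true}  q _ = sym (ℕ.+-identityʳ _)
  split {true}  {false} q f = contradiction (f tt) id
  split {false} {true}  q _ = refl
  split {false} {false} q _ = refl

2*m+1∸1/2≡m : ∀ m → (2 * m + 1 ∸ 1) / 2 ≡ m
2*m+1∸1/2≡m m = trans (cong (_/ 2) (trans (ℕ.m+n∸n≡m (2 * m) 1) (ℕ.*-comm 2 m))) (m*n/n≡m m 2)

2*[1+m]+1∸3/2≡m : ∀ m → (2 * suc m + 1 ∸ 3) / 2 ≡ m
2*[1+m]+1∸3/2≡m m = trans (cong (λ r → (r ∸ 3) / 2) (regroup m)) (m*n/n≡m m 2)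
  where
  regroup : ∀ m → 2 * suc m + 1 ≡ 3 + m * 2
  regroup = solve-∀

#-topPositive : ∀ n → # {n} topPositive ≡ (3 ^ n ∸ 1) / 2
#-topPositive n = trans (sym (2*m+1∸1/2≡m _)) (cong (λ r → (r ∸ 1) / 2) (begin
  2 * # {n} topPositive + 1                    ≡⟨ cong (λ r → 2 * r + 1) (#-cong {n} (λ t → ∧-identityʳ (topPositive t))) ⟨
  2 * # {n} (λ t → topPositive t ∧ true) + 1   ≡⟨ 2#-topPositive {n} (λ _ → true) ⟩
  # {n} (λ _ → true)                           ≡⟨ #-all {n} ⟩
  3 ^ n                                        ∎))
  where open ≡-Reasoning

#-isV₂ : ∀ n k → # {n} (isV₂ (suc k)) ≡ (3 ^ n ∸ 1) / 2 ∸ n C suc k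
#-isV₂ n k = begin
  # {n} (isV₂ (suc k))                                 ≡⟨ ℕ.m+n∸n≡m _ (n C suc k) ⟨
  # {n} (isV₂ (suc k)) + n C suc k ∸ n C suc k         ≡⟨ cong (_∸ n C suc k) total ⟩
  (3 ^ n ∸ 1) / 2 ∸ n C suc k                          ∎
  where
  open ≡-Reasoning
  drop-true : (f : Signed n → Bool) → # (λ t → f t ∧ true) ≡ # f
  drop-true f = #-cong λ t → ∧-identityʳ (f t)
  total : # {n} (isV₂ (suc k)) + n C suc k ≡ (3 ^ n ∸ 1) / 2
  total = begin
    # {n} (isV₂ (suc k)) + n C suc k
      ≡⟨ cong₂ _+_ (drop-true (isV₂ (suc k))) (trans (drop-true (isV₁ (suc k))) (#-isV₁ n (suc k))) ⟨
    # {n} (λ t → isV₂ (suc k) t ∧ true) + # {n} (λ t → isV₁ (suc k) t ∧ true)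
      ≡⟨ #-isV₂∧ {n} {k} (λ _ → true) ⟩
    # {n} (λ t → topPositive t ∧ true)
      ≡⟨ drop-true topPositive ⟩
    # {n} topPositive
      ≡⟨ #-topPositive n ⟩
    (3 ^ n ∸ 1) / 2 ∎

-- Among the vectors leading with `⊕`, `a` counts those with support below a set of size `suc k`,
-- `b` those with support above it, `c` those with both and `x` those with either; `d` omits from
-- `x` the single vector in V₁. Thus d = (a - 1) + (b - c), where a - 1 is half of 3^(k+1) - 3 and b
-- - c = 2^k (3^m - 1).
degree-arithmetic : ∀ k m {d x a b c} →
  2 * a + 1 ≡ 3 ^ suc k → 2 * b + 0 ≡ 2 ^ suc k * 3 ^ m → 2 * c + 0 ≡ 2 ^ suc k →
  x + c ≡ b + a → d + 1 ≡ x → d ≡ (3 ^ suc k ∸ 3) / 2 + 2 ^ k * (3 ^ m ∸ 1)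
-- With no vector below, 3 would divide 1. From here on `a` is a successor, which makes the
-- subtraction of 3 exact.
degree-arithmetic k m {a = zero} a≡ _ _ _ _ = contradiction (ℕ.m*n≡1⇒m≡1 3 (3 ^ k) (sym a≡)) λ ()
degree-arithmetic k m {d} {a = suc a} {b} {c} a≡ b≡ c≡ x≡ refl with 3 ^ m | ℕ.m^n>0 3 m
... | suc y | _ = begin
  -- The cancelled 1 stands for the vector in V₁, and 2 ^ k for the overlap `c`.
  d                                       ≡⟨ ℕ.+-cancelʳ-≡ (1 + 2 ^ k) d (a + 2 ^ k * y) shifted ⟩
  a + 2 ^ k * y                           ≡⟨ cong (_+ 2 ^ k * y) (trans (sym (2*[1+m]+1∸3/2≡m a)) (cong (λ r → (r ∸ 3) / 2) a≡)) ⟩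
  (3 ^ suc k ∸ 3) / 2 + 2 ^ k * y         ∎
  where
  open ≡-Reasoning
  halve : ∀ {r} q → 2 * r + 0 ≡ 2 * q → r ≡ q
  halve {r} q eq = ℕ.*-cancelˡ-≡ r q 2 (trans (sym (ℕ.+-identityʳ (2 * r))) eq)
  regroup : ∀ d e → d + (1 + e) ≡ d + 1 + e
  regroup = solve-∀
  collect : ∀ a e y → e * suc y + suc a ≡ a + e * y + (1 + e)
  collect = solve-∀
  shifted : d + (1 + 2 ^ k) ≡ a + 2 ^ k * y + (1 + 2 ^ k)
  shifted = begin
    d + (1 + 2 ^ k)           ≡⟨ regroup d (2 ^ k) ⟩
    d + 1 + 2 ^ k             ≡⟨ cong (d + 1 +_) (halve (2 ^ k) c≡) ⟨
    d + 1 + c                 ≡⟨ x≡ ⟩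
    b + suc a                 ≡⟨ cong (_+ suc a) (halve (2 ^ k * suc y) (trans b≡ (ℕ.*-assoc 2 (2 ^ k) (suc y)))) ⟩
    2 ^ k * suc y + suc a     ≡⟨ collect a (2 ^ k) y ⟩
    a + 2 ^ k * y + (1 + 2 ^ k) ∎

-- Inclusion–exclusion over supp t ⊆ p and p ⊆ supp t, where p = supp s; among the nested t
-- exactly one, namely s, lies in V₁.
#-isV₂-nested : ∀ {k} (s : Signed n) → T (isV₁ (suc k) s) →
  # (λ t → isV₂ (suc k) t ∧ nested (supp s) (supp t))
    ≡ (3 ^ suc k ∸ 3) / 2 + 2 ^ k * (3 ^ (n ∸ suc k) ∸ 1)
#-isV₂-nested {n} {k} s s∈ with _ , ∣p∣≡1+k ← isV₁⁻ s s∈ =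
  degree-arithmetic k (n ∸ suc k)
    {a = # (λ t → topPositive t ∧ does (supp t ⊆? p))} {b = # (λ t → topPositive t ∧ does (p ⊆? supp t))}
    below above equal inclusion-exclusion
    (trans (cong (# (λ t → isV₂ (suc k) t ∧ nested p (supp t)) +_) (sym (#-isV₁-nested s s∈)))
           (#-isV₂∧ {k = k} (λ t → nested p (supp t))))
  where
  p = supp s

  -- The null vector has no opposite to be paired with. Its support is below `p` but, `p` being
  -- nonempty, not above it: hence the correction 1 in `below` and 0 in `above` and `equal`.
  p⊈⊥ : does (p ⊆? ⊥) ≡ false
  p⊈⊥ = dec-false (p ⊆? ⊥) λ p⊆⊥ →
    contradiction (subst₂ ℕ._≤_ ∣p∣≡1+k (∣⊥∣≡0 n) (p⊆q⇒∣p∣≤∣q∣ p⊆⊥)) λ ()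

  below : 2 * # (λ t → topPositive t ∧ does (supp t ⊆? p)) + 1 ≡ 3 ^ suc k
  below = trans (cong (λ r → 2 * # (λ t → topPositive t ∧ does (supp t ⊆? p)) + bit r)
                      (sym (dec-true (⊥ ⊆? p) ⊥⊆)))
    (trans (2#-topPositive (λ q → does (q ⊆? p))) (trans (#-supp⊆ p) (cong (3 ^_) ∣p∣≡1+k)))

  above : 2 * # (λ t → topPositive t ∧ does (p ⊆? supp t)) + 0 ≡ 2 ^ suc k * 3 ^ (n ∸ suc k)
  above = trans (cong (λ r → 2 * # (λ t → topPositive t ∧ does (p ⊆? supp t)) + bit r) (sym p⊈⊥))
    (trans (2#-topPositive (λ q → does (p ⊆? q))) (trans (#-⊆supp p)
      (cong₂ (λ i j → 2 ^ i * 3 ^ j) ∣p∣≡1+k (trans (∣∁p∣≡n∸∣p∣ p) (cong (n ∸_) ∣p∣≡1+k)))))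

  equal : 2 * # (λ t → topPositive t ∧ (does (p ⊆? supp t) ∧ does (supp t ⊆? p))) + 0 ≡ 2 ^ suc k
  equal = trans (cong (λ r → 2 * # (λ t → topPositive t ∧ (does (p ⊆? supp t) ∧ does (supp t ⊆? p)))
                             + bit (r ∧ does (⊥ ⊆? p))) (sym p⊈⊥))
    (trans (2#-topPositive (λ q → does (p ⊆? q) ∧ does (q ⊆? p))) (trans (#-supp≡ p) (cong (2 ^_) ∣p∣≡1+k)))

  bit-∨-∧ : ∀ a b c → bit (a ∧ (b ∨ c)) + bit (a ∧ (b ∧ c)) ≡ bit (a ∧ b) + bit (a ∧ c)
  bit-∨-∧ false b     c = refl
  bit-∨-∧ true  false c = ℕ.+-identityʳ _
  bit-∨-∧ true  true  c = refl

  inclusion-exclusion :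
    # (λ t → topPositive t ∧ nested p (supp t)) + # (λ t → topPositive t ∧ (does (p ⊆? supp t) ∧ does (supp t ⊆? p)))
      ≡ # (λ t → topPositive t ∧ does (p ⊆? supp t)) + # (λ t → topPositive t ∧ does (supp t ⊆? p))
  inclusion-exclusion = #-+ λ t → bit-∨-∧ (topPositive t) (does (p ⊆? supp t)) (does (supp t ⊆? p))

-- Positive vectors, and sets of given size comparable with a given set

embed : Subset n → Signed n
embed = Vec.map λ { inside → ⊕ ; outside → 𝟘 }

embed-positive : (p : Subset n) → T (positive (embed p))
embed-positive []            = tt
embed-positive (inside ∷ p)  = embed-positive p
embed-positive (outside ∷ p) = embed-positive p

supp-embed : (p : Subset n) → supp (embed p) ≡ p
supp-embed []            = refl
supp-embed (inside ∷ p)  = cong (inside ∷_) (supp-embed p)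
supp-embed (outside ∷ p) = cong (outside ∷_) (supp-embed p)

-- Greedy choice: members of `q` are taken while `k` lasts, which keeps the result inside `q`. A
-- non-member is taken only when all remaining positions have to be filled, and then `⊤` contains
-- what remains of `q`.
comparable-of-size : (q : Subset n) {k : ℕ} → k ℕ.≤ n → ∃[ p ] ∣ p ∣ ≡ k × (p ⊆ q ⊎ q ⊆ p)
comparable-of-size [] z≤n = [] , refl , inj₁ ⊆-refl
comparable-of-size {suc n} (inside ∷ q) {zero}  _ = ⊥ , ∣⊥∣≡0 n , inj₁ ⊥⊆
comparable-of-size (inside ∷ q) {suc k} (s≤s k≤n) =
  let p , w , s = comparable-of-size q k≤n in inside ∷ p , cong suc w , Sum.map s⊆s s⊆s s
comparable-of-size {suc n} (outside ∷ q) k≤1+n with ℕ.m≤n⇒m<n∨m≡n k≤1+n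
... | inj₁ (s≤s k≤n) = let p , w , s = comparable-of-size q k≤n in outside ∷ p , w , Sum.map s⊆s s⊆s s
... | inj₂ refl      = ⊤ , ∣⊤∣≡n (suc n) , inj₂ ⊆⊤

-- Real numbers

infix 4 _≐_

-- Stronger than `_≈_`: the sequences agree from some index on. This holds between a positive real
-- and its absolute value, and it carries `_<_` over with the same gap.
_≐_ : Rel ℝ 0ℓ
x ≐ y = ∃[ N ] ∀ n → N ℕ.≤ n → seq x n ≡ seq y n

≐-sym : ∀ {x y} → x ≐ y → y ≐ x
≐-sym (N , eq) = N , λ n N≤n → sym (eq n N≤n)

≈-refl : ∀ {x} → x ≈ x
≈-refl {x} ε 0<ε = 0 , λ n _ → subst (λ r → ℚ.∣ r ∣ ℚ.< ε) (sym (ℚ.+-inverseʳ (seq x n))) 0<ε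

≈-respʳ-≐ : ∀ {x y z} → y ≐ z → x ≈ y → x ≈ z
≈-respʳ-≐ {x} (M , eq) x≈y ε 0<ε with N , close ← x≈y ε 0<ε = N ℕ.⊔ M , λ n h →
  subst (λ r → ℚ.∣ seq x n ℚ.- r ∣ ℚ.< ε) (eq n (ℕ.m⊔n≤o⇒n≤o N M h)) (close n (ℕ.m⊔n≤o⇒m≤o N M h))

≈-respˡ-≐ : ∀ {x y z} → x ≐ y → x ≈ z → y ≈ z
≈-respˡ-≐ {z = z} (M , eq) x≈z ε 0<ε with N , close ← x≈z ε 0<ε = N ℕ.⊔ M , λ n h →
  subst (λ r → ℚ.∣ r ℚ.- seq z n ∣ ℚ.< ε) (eq n (ℕ.m⊔n≤o⇒n≤o N M h)) (close n (ℕ.m⊔n≤o⇒m≤o N M h))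

<-resp-≐ : ∀ {x x′ y y′} → x ≐ x′ → y ≐ y′ → x < y → x′ < y′
<-resp-≐ (M , eqˣ) (M′ , eqʸ) (ε , 0<ε , N , gap) = ε , 0<ε , N ℕ.⊔ (M ℕ.⊔ M′) , λ n h →
  let h′ = ℕ.m⊔n≤o⇒n≤o N _ h in
  subst₂ (λ p q → p ℚ.+ ε ℚ.≤ q) (eqˣ n (ℕ.m⊔n≤o⇒m≤o M M′ h′)) (eqʸ n (ℕ.m⊔n≤o⇒n≤o M M′ h′))
    (gap n (ℕ.m⊔n≤o⇒m≤o N _ h))

p<p+ε : ∀ p {ε} → 0ℚ ℚ.< ε → p ℚ.< p ℚ.+ ε
p<p+ε p 0<ε = subst (ℚ._< p ℚ.+ _) (ℚ.+-identityʳ p) (ℚ.+-monoʳ-< p 0<ε)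

p≤∣p∣ : ∀ p → p ℚ.≤ ℚ.∣ p ∣
p≤∣p∣ p with ℚ.≤-total 0ℚ p
... | inj₁ 0≤p = ℚ.≤-reflexive (sym (ℚ.0≤p⇒∣p∣≡p 0≤p))
... | inj₂ p≤0 = ℚ.≤-trans p≤0 (ℚ.0≤∣p∣ p)

∣p-q∣≡∣q-p∣ : ∀ p q → ℚ.∣ p ℚ.- q ∣ ≡ ℚ.∣ q ℚ.- p ∣
∣p-q∣≡∣q-p∣ p q = trans (sym (ℚ.∣-p∣≡∣p∣ (p ℚ.- q))) (cong ℚ.∣_∣ (⁻¹-anti-homo-// ℚ.+-0-group p q))

≈-sym : ∀ {x y} → x ≈ y → y ≈ x
≈-sym {x} {y} x≈y ε 0<ε with N , close ← x≈y ε 0<ε =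
  N , λ n N≤n → subst (ℚ._< ε) (∣p-q∣≡∣q-p∣ (seq x n) (seq y n)) (close n N≤n)

<-asym : ∀ {x y} → x < y → ¬ y < x
<-asym {x} {y} (ε , 0<ε , N , gap) (ε′ , 0<ε′ , N′ , gap′) = ℚ.<-irrefl refl (begin-strict
  seq x m          <⟨ p<p+ε (seq x m) 0<ε ⟩
  seq x m ℚ.+ ε    ≤⟨ gap m (ℕ.m≤m⊔n N N′) ⟩
  seq y m          <⟨ p<p+ε (seq y m) 0<ε′ ⟩
  seq y m ℚ.+ ε′   ≤⟨ gap′ m (ℕ.m≤n⊔m N N′) ⟩
  seq x m          ∎)
  where
  open ℚ.≤-Reasoning
  m = N ℕ.⊔ N′

-- The gap of `x < y`, used as the tolerance of `y ≈ x`, is violated beyond both thresholds.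
<⇒≉ : ∀ {x y} → x < y → ¬ y ≈ x
<⇒≉ {x} {y} (ε , 0<ε , N , gap) y≈x with N′ , close ← y≈x ε 0<ε =
  ℚ.<-irrefl refl (begin-strict
    ε                              ≡⟨ ℚ.+-identityʳ ε ⟨
    ε ℚ.+ 0ℚ                       ≡⟨ cong (ε ℚ.+_) (ℚ.+-inverseʳ (seq x m)) ⟨
    ε ℚ.+ (seq x m ℚ.- seq x m)    ≡⟨ ℚ.+-assoc ε (seq x m) _ ⟨
    ε ℚ.+ seq x m ℚ.- seq x m      ≡⟨ cong (ℚ._- seq x m) (ℚ.+-comm ε (seq x m)) ⟩
    seq x m ℚ.+ ε ℚ.- seq x m      ≤⟨ ℚ.+-monoˡ-≤ (ℚ.- seq x m) (gap m (ℕ.m≤m⊔n N N′)) ⟩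
    seq y m ℚ.- seq x m            ≤⟨ p≤∣p∣ _ ⟩
    ℚ.∣ seq y m ℚ.- seq x m ∣      <⟨ close m (ℕ.m≤n⊔m N N′) ⟩
    ε                              ∎)
  where
  open ℚ.≤-Reasoning
  m = N ℕ.⊔ N′

0<x⇒-x<0 : ∀ {x} → 0ℝ < x → - x < 0ℝ
0<x⇒-x<0 {x} (ε , 0<ε , N , gap) = ε , 0<ε , N , λ n N≤n → begin
  ℚ.- seq x n ℚ.+ ε            ≤⟨ ℚ.+-monoʳ-≤ (ℚ.- seq x n) (subst (ℚ._≤ seq x n) (ℚ.+-identityˡ ε) (gap n N≤n)) ⟩
  ℚ.- seq x n ℚ.+ seq x n      ≡⟨ ℚ.+-inverseˡ (seq x n) ⟩
  0ℚ                           ∎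
  where open ℚ.≤-Reasoning

<-trans : ∀ {x y z} → x < y → y < z → x < z
<-trans {x} {y} {z} (ε , 0<ε , N , gap) (ε′ , 0<ε′ , N′ , gap′) = ε , 0<ε , N ℕ.⊔ N′ , λ n h → begin
  seq x n ℚ.+ ε    ≤⟨ gap n (ℕ.m⊔n≤o⇒m≤o N N′ h) ⟩
  seq y n          ≤⟨ ℚ.<⇒≤ (p<p+ε (seq y n) 0<ε′) ⟩
  seq y n ℚ.+ ε′   ≤⟨ gap′ n (ℕ.m⊔n≤o⇒n≤o N N′ h) ⟩
  seq z n          ∎
  where open ℚ.≤-Reasoning

0<x⇒∣x∣≐x : ∀ {x} → 0ℝ < x → abs x ≐ x
0<x⇒∣x∣≐x {x} (ε , 0<ε , N , gap) = N , λ n N≤n → ℚ.0≤p⇒∣p∣≡p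
  (ℚ.≤-trans (ℚ.<⇒≤ (p<p+ε 0ℚ 0<ε)) (gap n N≤n))

0<x⇒∣-x∣≐x : ∀ {x} → 0ℝ < x → abs (- x) ≐ x
0<x⇒∣-x∣≐x {x} 0<x with N , eq ← 0<x⇒∣x∣≐x {x} 0<x =
  N , λ n N≤n → trans (ℚ.∣-p∣≡∣p∣ (seq x n)) (eq n N≤n)

-- Sign vectors as subsets of 𝓑ₙ

infix 4 _≟_

_≟_ : DecidableEquality Trit
𝟘 ≟ 𝟘 = yes refl
𝟘 ≟ ⊕ = no λ ()
𝟘 ≟ ⊖ = no λ ()
⊕ ≟ 𝟘 = no λ ()
⊕ ≟ ⊕ = yes refl
⊕ ≟ ⊖ = no λ ()
⊖ ≟ 𝟘 = no λ ()
⊖ ≟ ⊕ = no λ ()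
⊖ ≟ ⊖ = yes refl

positive⁻ : (t : Signed n) → T (positive t) → ∀ i → lookup t i ≢ ⊖
positive⁻ (𝟘 ∷ t) p zero ()
positive⁻ (⊕ ∷ t) p zero ()
positive⁻ (𝟘 ∷ t) p (suc i) = positive⁻ t p i
positive⁻ (⊕ ∷ t) p (suc i) = positive⁻ t p i

positive⁺ : (t : Signed n) → (∀ i → lookup t i ≢ ⊖) → T (positive t)
positive⁺ []      _ = tt
positive⁺ (𝟘 ∷ t) p = positive⁺ t (p ∘ suc)
positive⁺ (⊕ ∷ t) p = positive⁺ t (p ∘ suc)
positive⁺ (⊖ ∷ t) p = contradiction refl (p zero)

null⁻ : (t : Signed n) → T (null t) → ∀ i → lookup t i ≡ 𝟘
null⁻ (𝟘 ∷ t) z zero    = refl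
null⁻ (𝟘 ∷ t) z (suc i) = null⁻ t z i

null⁺ : (t : Signed n) → (∀ i → ¬ lookup t i ≢ 𝟘) → T (null t)
null⁺ []      _ = tt
null⁺ (𝟘 ∷ t) z = null⁺ t (z ∘ suc)
null⁺ (⊕ ∷ t) z = z zero λ ()
null⁺ (⊖ ∷ t) z = z zero λ ()

Leads : Signed n → Fin n → Set
Leads t i = lookup t i ≡ ⊕ × (∀ {j} → lookup t j ≢ 𝟘 → j Fin.≤ i)

topPositive⁻ : (t : Signed n) → T (topPositive t) → ∃[ i ] Leads t i
topPositive⁻ {suc n} (a ∷ t) top = split a top
  where
  shift : ∀ a → T (topPositive t) → ∃[ i ] Leads (a ∷ t) i
  shift a top with i , lead , above ← topPositive⁻ t top =
    suc i , lead , λ { {zero} _ → z≤n ; {suc j} nz → s≤s (above nz) }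
  split : ∀ a → T (topPositive (a ∷ t)) → ∃[ i ] Leads (a ∷ t) i
  split 𝟘 top = shift 𝟘 top
  split ⊖ top = shift ⊖ top
  split ⊕ top with Equivalence.to (T-∨ {x = topPositive t}) top
  ... | inj₁ top′ = shift ⊕ top′
  ... | inj₂ z    = zero , refl , λ { {zero} _ → z≤n ; {suc j} nz → contradiction (null⁻ t z j) nz }

topPositive⁺ : (t : Signed n) → ∀ {i} → Leads t i → T (topPositive t)
topPositive⁺ (⊕ ∷ t) {zero} (_ , above) =
  Equivalence.from (T-∨ {x = topPositive t}) (inj₂ (null⁺ t λ j nz → contradiction (above {suc j} nz) λ ()))
topPositive⁺ (a ∷ t) {suc i} (lead , above) = split a (topPositive⁺ t (lead , λ {j} nz → ℕ.s≤s⁻¹ (above {suc j} nz)))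
  where
  split : ∀ a → T (topPositive t) → T (topPositive (a ∷ t))
  split 𝟘 top = top
  split ⊖ top = top
  split ⊕ top = Equivalence.from (T-∨ {x = topPositive t}) (inj₁ top)

∈-supp⁺ : (t : Signed n) → ∀ {j} → lookup t j ≢ 𝟘 → j Subset.∈ supp t
∈-supp⁺ t {j} tj≢𝟘 = lookup⇒[]= j (supp t) (trans (lookup-map j nonzero t) (inside! tj≢𝟘))
  where
  inside! : ∀ {a} → a ≢ 𝟘 → nonzero a ≡ inside
  inside! {𝟘} a≢𝟘 = contradiction refl a≢𝟘
  inside! {⊕} _   = refl
  inside! {⊖} _   = refl

∈-supp⁻ : (t : Signed n) → ∀ {j} → j Subset.∈ supp t → lookup t j ≢ 𝟘
∈-supp⁻ t {j} j∈ tj≡𝟘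
  with () ← trans (sym ([]=⇒lookup j∈)) (trans (lookup-map j nonzero t) (cong nonzero tj≡𝟘))

∣tabulate∣-+ : ∀ m {l} (f : Fin (m + l) → Bool) →
  ∣ tabulate f ∣ ≡ ∣ tabulate (f ∘ (_↑ˡ l)) ∣ + ∣ tabulate (f ∘ (m ↑ʳ_)) ∣
∣tabulate∣-+ zero    f = refl
∣tabulate∣-+ (suc m) f with f zero
... | true  = cong suc (∣tabulate∣-+ m (f ∘ suc))
... | false = ∣tabulate∣-+ m (f ∘ suc)

∣tabulate-false∣ : (f : Fin n → Bool) → (∀ i → f i ≡ false) → ∣ tabulate f ∣ ≡ 0
∣tabulate-false∣ {zero}  f _ = refl
∣tabulate-false∣ {suc n} f h rewrite h zero = ∣tabulate-false∣ (f ∘ suc) (h ∘ suc)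

T-not⁻ : ∀ {c} → T (not c) → ¬ T c
T-not⁻ {false} _ ()

T-not⁺ : ∀ {c} → ¬ T c → T (not c)
T-not⁺ {false} _ = tt
T-not⁺ {true}  f = f tt

isV₂⁻ : ∀ {k} (t : Signed n) → T (isV₂ k t) → T (topPositive t) × ¬ T (isV₁ k t)
isV₂⁻ t v = let top , ¬v₁ = Equivalence.to (T-∧ {x = topPositive t}) v in top , T-not⁻ ¬v₁

isV₂⁺ : ∀ {k} (t : Signed n) → T (topPositive t) → ¬ T (isV₁ k t) → T (isV₂ k t)
isV₂⁺ t top ¬v₁ = Equivalence.from (T-∧ {x = topPositive t}) (top , T-not⁺ ¬v₁)

module SignedSubsets (n : ℕ) where

  Index : Set
  Index = Fin (n + (n ∸ 1))

  -- Together with `sgn`, this reads position `i` in the listing of 𝓑ₙ as the element `x (idx i)`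
  -- with sign `sgn i`.
  idx : Index → Fin n
  idx i = [ id , (λ j → inject≤ j (ℕ.m∸n≤m n 1)) ]′ (splitAt n i)

  sgn : Index → Trit
  sgn i = [ const ⊕ , const ⊖ ]′ (splitAt n i)

  sgn-cases : ∀ i → sgn i ≡ ⊕ ⊎ sgn i ≡ ⊖
  sgn-cases i with splitAt n i
  ... | inj₁ _ = inj₁ refl
  ... | inj₂ _ = inj₂ refl

  sgn≢𝟘 : ∀ i → sgn i ≢ 𝟘
  sgn≢𝟘 i eq with sgn-cases i
  ... | inj₁ e with () ← trans (sym e) eq
  ... | inj₂ e with () ← trans (sym e) eq

  index-injective : ∀ {i j} → idx i ≡ idx j → sgn i ≡ sgn j → i ≡ j
  index-injective {i} {j} eq eq′ with splitAt n i in splitᵢ | splitAt n j in splitⱼ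
  ... | inj₁ p | inj₁ q with refl ← eq = trans (sym (Fin.splitAt⁻¹-↑ˡ splitᵢ)) (Fin.splitAt⁻¹-↑ˡ splitⱼ)
  ... | inj₂ p | inj₂ q = trans (sym (Fin.splitAt⁻¹-↑ʳ splitᵢ))
    (trans (cong (n ↑ʳ_) (Fin.inject≤-injective _ _ p q eq)) (Fin.splitAt⁻¹-↑ʳ splitⱼ))

  idx-↑ˡ : ∀ j → idx (j ↑ˡ (n ∸ 1)) ≡ j
  idx-↑ˡ j rewrite Fin.splitAt-↑ˡ n j (n ∸ 1) = refl

  sgn-↑ˡ : ∀ j → sgn (j ↑ˡ (n ∸ 1)) ≡ ⊕
  sgn-↑ˡ j rewrite Fin.splitAt-↑ˡ n j (n ∸ 1) = refl

  sgn-↑ʳ : ∀ j → sgn (n ↑ʳ j) ≡ ⊖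
  sgn-↑ʳ j rewrite Fin.splitAt-↑ʳ n (n ∸ 1) j = refl

  idx-↑ʳ : ∀ j → idx (n ↑ʳ j) ≡ inject≤ j (ℕ.m∸n≤m n 1)
  idx-↑ʳ j rewrite Fin.splitAt-↑ʳ n (n ∸ 1) j = refl

  -- Only the last element has no negative in the listing, and `l` above `j` shows that `j` is not
  -- last.
  negative-index : ∀ {j l : Fin n} → j <ᶠ l → ∃[ i ] idx i ≡ j × sgn i ≡ ⊖
  negative-index {j} {l} j<l = n ↑ʳ fromℕ< j<n-1 ,
    trans (idx-↑ʳ (fromℕ< j<n-1)) (Fin.toℕ-injective (trans (Fin.toℕ-inject≤ (fromℕ< j<n-1) (ℕ.m∸n≤m n 1)) (Fin.toℕ-fromℕ< j<n-1))) ,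
    sgn-↑ʳ (fromℕ< j<n-1)
    where
    j<n-1 : toℕ j <ℕ n ∸ 1
    j<n-1 = ℕ.<-≤-trans j<l (ℕ.∸-monoˡ-≤ 1 (Fin.toℕ<n l))

  -- A `⊖` stands strictly below the leading `⊕`, hence not in the last coordinate, so its negative
  -- is available in 𝓑ₙ.
  index-of : ∀ (t : Signed n) → T (topPositive t) → ∀ j → lookup t j ≢ 𝟘 →
             ∃[ i ] idx i ≡ j × sgn i ≡ lookup t j
  index-of t top j nz with lookup t j in eq
  ... | 𝟘 = contradiction refl nz
  ... | ⊕ = j ↑ˡ (n ∸ 1) , idx-↑ˡ j , sgn-↑ˡ j
  ... | ⊖ with l , lead , above ← topPositive⁻ t top = negative-index (ℕ.≤∧≢⇒< (above tj≢𝟘) j≢l)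
    where
    tj≢𝟘 : lookup t j ≢ 𝟘
    tj≢𝟘 e with () ← trans (sym eq) e
    j≢l : toℕ j ≢ toℕ l
    j≢l e with refl ← Fin.toℕ-injective {i = j} {l} e with () ← trans (sym eq) lead

  encode : Signed n → Subset (n + (n ∸ 1))
  encode t = tabulate λ i → does (lookup t (idx i) ≟ sgn i)

  ∈-encode⁺ : ∀ t {i} → lookup t (idx i) ≡ sgn i → i Subset.∈ encode t
  ∈-encode⁺ t {i} eq = lookup⇒[]= i (encode t)
    (trans (lookup∘tabulate _ i) (dec-true (lookup t (idx i) ≟ sgn i) eq))

  ∈-encode⁻ : ∀ t {i} → i Subset.∈ encode t → lookup t (idx i) ≡ sgn i
  ∈-encode⁻ t {i} i∈ with lookup t (idx i) ≟ sgn i | trans (sym (lookup∘tabulate _ i)) ([]=⇒lookup i∈)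
  ... | yes eq | _ = eq

  -- A `⊖` in the last coordinate matches no index and would be lost by `encode`; when the last
  -- nonzero entry is `⊕`, every nonzero entry leaves a trace.
  encode-injective : ∀ s t → T (topPositive s) → T (topPositive t) → encode s ≡ encode t → s ≡ t
  encode-injective s t tops topt eq =
    trans (sym (tabulate∘lookup s)) (trans (tabulate-cong agree) (tabulate∘lookup t))
    where
    transfer : ∀ {s t} → T (topPositive s) → encode s ≡ encode t → ∀ j → lookup s j ≢ 𝟘 → lookup t j ≡ lookup s j
    transfer {s} {t} tops eq j nz with i , refl , e ← index-of s tops j nz =
      trans (∈-encode⁻ t (subst (i Subset.∈_) eq (∈-encode⁺ s (sym e)))) e
    agree : ∀ j → lookup s j ≡ lookup t j
    agree j with lookup s j ≟ 𝟘 | lookup t j ≟ 𝟘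
    ... | yes s≡𝟘 | yes t≡𝟘 = trans s≡𝟘 (sym t≡𝟘)
    ... | no s≢𝟘  | _       = sym (transfer {s} {t} tops eq j s≢𝟘)
    ... | _       | no t≢𝟘  = transfer {t} {s} topt (sym eq) j t≢𝟘

  -- The condition says that distinct members have distinct absolute values, in terms of indices. It
  -- serves members of V₁, where it comes from all signs being `⊕`, and members of `φ`, where it
  -- comes from `DistinctAbs`.
  module Decoding (S : Subset (n + (n ∸ 1))) (idx-injective : ∀ {i j} → i Subset.∈ S → j Subset.∈ S → idx i ≡ idx j → i ≡ j) where

    entry : Fin n → Trit
    entry j with Fin.any? (λ i → i ∈? S ×-dec idx i Fin.≟ j)
    ... | yes (i , _) = sgn i
    ... | no _        = 𝟘

    entry⁺ : ∀ {i} → i Subset.∈ S → entry (idx i) ≡ sgn i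
    entry⁺ {i} i∈ with Fin.any? (λ i′ → i′ ∈? S ×-dec idx i′ Fin.≟ idx i)
    ... | yes (i′ , i′∈ , eq) = cong sgn (idx-injective i′∈ i∈ eq)
    ... | no ¬i               = contradiction (i , i∈ , refl) ¬i

    entry⁻ : ∀ j → entry j ≢ 𝟘 → ∃[ i ] i Subset.∈ S × idx i ≡ j × sgn i ≡ entry j
    entry⁻ j nz with Fin.any? (λ i → i ∈? S ×-dec idx i Fin.≟ j)
    ... | yes (i , i∈ , eq) = i , i∈ , eq , refl
    ... | no _              = contradiction refl nz

    decode : Signed n
    decode = tabulate entry

    encode-decode : encode decode ≡ S
    encode-decode = ⊆-antisym to from
      where
      to : encode decode ⊆ S
      to {i} i∈ with e ← trans (sym (lookup∘tabulate entry (idx i))) (∈-encode⁻ decode i∈)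
        with i′ , i′∈ , eq , eq′ ← entry⁻ (idx i) (sgn≢𝟘 i ∘ trans (sym e))
        with refl ← index-injective eq (trans eq′ e) = i′∈
      from : S ⊆ encode decode
      from {i} i∈ = ∈-encode⁺ decode (trans (lookup∘tabulate entry (idx i)) (entry⁺ i∈))

    decode-positive : (∀ {i} → i Subset.∈ S → sgn i ≡ ⊕) → T (positive decode)
    decode-positive plus = positive⁺ decode λ j e → absurd j (trans (sym (lookup∘tabulate entry j)) e)
      where
      absurd : ∀ j → entry j ≢ ⊖
      absurd j e with i , i∈ , _ , e′ ← entry⁻ j (λ e₀ → contradiction (trans (sym e₀) e) λ ())
        with () ← trans (sym (plus i∈)) (trans e′ e)

    decode-topPositive : ∀ {i} → i Subset.∈ S → sgn i ≡ ⊕ → (∀ {j} → j Subset.∈ S → idx j Fin.≤ idx i) →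
                         T (topPositive decode)
    decode-topPositive {i} i∈ plus largest = topPositive⁺ decode {idx i}
      (trans (lookup∘tabulate entry (idx i)) (trans (entry⁺ i∈) plus) , above)
      where
      above : ∀ {j} → lookup decode j ≢ 𝟘 → j Fin.≤ idx i
      above {j} nz with _ , i′∈ , refl , _ ← entry⁻ j (nz ∘ trans (lookup∘tabulate entry j)) = largest i′∈

  ∈-encode⇒≢𝟘 : ∀ t {i} → i Subset.∈ encode t → lookup t (idx i) ≢ 𝟘
  ∈-encode⇒≢𝟘 t {i} i∈ e = sgn≢𝟘 i (trans (sym (∈-encode⁻ t i∈)) e)

  ≢𝟘⇒∈-encode : ∀ t → T (topPositive t) → ∀ j → lookup t j ≢ 𝟘 → ∃[ i ] i Subset.∈ encode t × idx i ≡ j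
  ≢𝟘⇒∈-encode t top j tj≢𝟘 with i , refl , e ← index-of t top j tj≢𝟘 = i , ∈-encode⁺ t (sym e) , refl

  encode-positive : ∀ t → T (positive t) → ∀ {i} → i Subset.∈ encode t → sgn i ≡ ⊕
  encode-positive t pos {i} i∈ with sgn-cases i
  ... | inj₁ e = e
  ... | inj₂ e = contradiction (trans (∈-encode⁻ t i∈) e) (positive⁻ t pos (idx i))

  encode-idx-injective : ∀ t {i j} → i Subset.∈ encode t → j Subset.∈ encode t → idx i ≡ idx j → i ≡ j
  encode-idx-injective t i∈ j∈ eq =
    index-injective eq (trans (sym (∈-encode⁻ t i∈)) (trans (cong (lookup t) eq) (∈-encode⁻ t j∈)))

  encode-leader : ∀ t → T (topPositive t) → ∃[ i ] i Subset.∈ encode t × sgn i ≡ ⊕ ×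
                  (∀ {j} → j Subset.∈ encode t → idx j Fin.≤ idx i)
  encode-leader t top with l , lead , above ← topPositive⁻ t top =
    l ↑ˡ (n ∸ 1) ,
    ∈-encode⁺ t (trans (cong (lookup t) (idx-↑ˡ l)) (trans lead (sym (sgn-↑ˡ l)))) ,
    sgn-↑ˡ l ,
    λ j∈ → subst (_ Fin.≤_) (sym (idx-↑ˡ l)) (above (∈-encode⇒≢𝟘 t j∈))

  -- Without minus signs, the block of positive elements is a copy of the support and the block of
  -- negative elements is empty.
  ∣encode∣ : ∀ t → T (positive t) → ∣ encode t ∣ ≡ ∣ supp t ∣
  ∣encode∣ t pos = begin
    ∣ encode t ∣                                  ≡⟨ ∣tabulate∣-+ n member ⟩
    ∣ tabulate (member ∘ (_↑ˡ (n ∸ 1))) ∣ + ∣ tabulate (member ∘ (n ↑ʳ_)) ∣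
      ≡⟨ cong₂ _+_ (cong ∣_∣ (trans (tabulate-cong left) (tabulate∘lookup (supp t)))) (∣tabulate-false∣ _ right) ⟩
    ∣ supp t ∣ + 0                                ≡⟨ ℕ.+-identityʳ _ ⟩
    ∣ supp t ∣                                    ∎
    where
    open ≡-Reasoning
    member : Index → Bool
    member i = does (lookup t (idx i) ≟ sgn i)
    right : ∀ j → member (n ↑ʳ j) ≡ false
    right j rewrite sgn-↑ʳ j = dec-false (_ ≟ ⊖) (positive⁻ t pos _)
    left : ∀ j → member (j ↑ˡ (n ∸ 1)) ≡ lookup (supp t) j
    left j rewrite idx-↑ˡ j | sgn-↑ˡ j | lookup-map j nonzero t with lookup t j | positive⁻ t pos j
    ... | 𝟘 | _ = refl
    ... | ⊕ | _ = refl
    ... | ⊖ | f = contradiction refl f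

-- Membership in V₁ and V₂, and adjacency, in terms of sign vectors

module Encoding (n k : ℕ) (x : Fin n → ℝ) (0<x : ∀ i → 0ℝ < x i)
                (x-mono : ∀ {i j} → i <ᶠ j → x i < x j) where

  open BipartiteKneserB n (suc k) x

  open SignedSubsets n

  b-⊕ : ∀ i → sgn i ≡ ⊕ → b i ≡ x (idx i)
  b-⊕ i eq with splitAt n i
  ... | inj₁ _ = refl

  b-⊖ : ∀ i → sgn i ≡ ⊖ → b i ≡ - x (idx i)
  b-⊖ i eq with splitAt n i
  ... | inj₂ _ = refl

  -- The bridge from reals to indices: through it, equality and order of absolute values become
  -- equality and order of `idx`.
  ∣b∣≐x : ∀ i → abs (b i) ≐ x (idx i)
  ∣b∣≐x i with sgn-cases i
  ... | inj₁ e rewrite b-⊕ i e = 0<x⇒∣x∣≐x {x (idx i)} (0<x (idx i))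
  ... | inj₂ e rewrite b-⊖ i e = 0<x⇒∣-x∣≐x {x (idx i)} (0<x (idx i))

  x-injective : ∀ {i j} → x i ≈ x j → i ≡ j
  x-injective {i} {j} eq with Fin.<-cmp i j
  ... | tri< i<j _ _ = contradiction (≈-sym {x i} {x j} eq) (<⇒≉ {x i} {x j} (x-mono i<j))
  ... | tri≈ _ i≡j _ = i≡j
  ... | tri> _ _ j<i = contradiction eq (<⇒≉ {x j} {x i} (x-mono j<i))

  x≉-x : ∀ i j → ¬ x i ≈ - x j
  x≉-x i j = <⇒≉ { - x j} {x i} (<-trans { - x j} {0ℝ} {x i} (0<x⇒-x<0 {x j} (0<x j)) (0<x i))

  ∣b∣≈∣b∣⁻ : ∀ {i j} → abs (b i) ≈ abs (b j) → idx i ≡ idx j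
  ∣b∣≈∣b∣⁻ {i} {j} eq = x-injective
    (≈-respˡ-≐ {abs (b i)} {x (idx i)} {x (idx j)} (∣b∣≐x i) (≈-respʳ-≐ {abs (b i)} {abs (b j)} {x (idx j)} (∣b∣≐x j) eq))

  ∣b∣≈∣b∣⁺ : ∀ {i j} → idx i ≡ idx j → abs (b i) ≈ abs (b j)
  ∣b∣≈∣b∣⁺ {i} {j} eq = ≈-respʳ-≐ {abs (b i)} {x (idx j)} {abs (b j)} (≐-sym {abs (b j)} {x (idx j)} (∣b∣≐x j))
    (subst (λ l → abs (b i) ≈ x l) eq (≈-respʳ-≐ {abs (b i)} {abs (b i)} {x (idx i)} (∣b∣≐x i) (≈-refl {abs (b i)})))

  ∣b∣≤∣b∣⁻ : ∀ {i j} → abs (b i) ≤ abs (b j) → idx i Fin.≤ idx j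
  ∣b∣≤∣b∣⁻ {i} {j} i≤j = ℕ.≮⇒≥ λ j<i →
    i≤j (<-resp-≐ {x (idx j)} {abs (b j)} {x (idx i)} {abs (b i)}
      (≐-sym {abs (b j)} {x (idx j)} (∣b∣≐x j)) (≐-sym {abs (b i)} {x (idx i)} (∣b∣≐x i)) (x-mono j<i))

  ∣b∣≤∣b∣⁺ : ∀ {i j} → idx i Fin.≤ idx j → abs (b i) ≤ abs (b j)
  ∣b∣≤∣b∣⁺ {i} {j} i≤j ∣bj∣<∣bi∣ with ℕ.m≤n⇒m<n∨m≡n i≤j
    | <-resp-≐ {abs (b j)} {x (idx j)} {abs (b i)} {x (idx i)} (∣b∣≐x j) (∣b∣≐x i) ∣bj∣<∣bi∣
  ... | inj₁ i<j | xj<xi = <-asym {x (idx j)} {x (idx i)} xj<xi (x-mono i<j)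
  ... | inj₂ eq  | xj<xi = <-asym {x (idx j)} {x (idx j)} xj<xj xj<xj
    where xj<xj = subst (λ l → x (idx j) < x l) (Fin.toℕ-injective eq) xj<xi

  ⊆B⁺⇒⊕ : ∀ S → ⟦ S ⟧ Pred.⊆ B⁺ → ∀ {i} → i Subset.∈ S → sgn i ≡ ⊕
  ⊆B⁺⇒⊕ S ⊆B⁺ {i} i∈ = [ id , (λ e → contradiction
      (≈-sym { - x (idx i)} {x (proj₁ bi∈B⁺)} (subst (_≈ x (proj₁ bi∈B⁺)) (b-⊖ i e) (proj₂ bi∈B⁺)))
      (x≉-x (proj₁ bi∈B⁺) (idx i))) ]′ (sgn-cases i)
    where
    bi∈B⁺ : B⁺ (b i)
    bi∈B⁺ = ⊆B⁺ {b i} (i , i∈ , ≈-refl {b i})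

  0<b⇒⊕ : ∀ i → 0ℝ < b i → sgn i ≡ ⊕
  0<b⇒⊕ i 0<bi = [ id , (λ e → contradiction (0<x⇒-x<0 {x (idx i)} (0<x (idx i)))
    (<-asym {0ℝ} { - x (idx i)} (subst (0ℝ <_) (b-⊖ i e) 0<bi))) ]′ (sgn-cases i)

  V₁-encode⁺ : ∀ t → T (isV₁ (suc k) t) → V₁ (encode t)
  V₁-encode⁺ t v =
    (λ {r} (i , i∈ , r≈bi) → idx i , subst (r ≈_) (b-⊕ i (encode-positive t pos i∈)) r≈bi) ,
    trans (∣encode∣ t pos) (proj₂ (isV₁⁻ t v))
    where pos = proj₁ (isV₁⁻ t v)

  V₁-decode : ∀ S → V₁ S → ∃[ t ] encode t ≡ S × T (isV₁ (suc k) t)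
  V₁-decode S (⊆B⁺ , ∣S∣≡k) = decode , encode-decode , isV₁⁺ decode pos
    (trans (sym (∣encode∣ decode pos)) (trans (cong ∣_∣ encode-decode) ∣S∣≡k))
    where
    plus : ∀ {i} → i Subset.∈ S → sgn i ≡ ⊕
    plus = ⊆B⁺⇒⊕ S (λ {r} → ⊆B⁺ {r})
    open Decoding S (λ i∈ j∈ eq → index-injective eq (trans (plus i∈) (sym (plus j∈))))
    pos : T (positive decode)
    pos = decode-positive plus

  V₁-encode⁻ : ∀ t → T (topPositive t) → V₁ (encode t) → T (isV₁ (suc k) t)
  V₁-encode⁻ t top v = transfer (V₁-decode (encode t) v)
    where
    transfer : ∃[ s ] encode s ≡ encode t × T (isV₁ (suc k) s) → T (isV₁ (suc k) t)
    transfer (s , eq , s∈) = subst (T ∘ isV₁ (suc k)) (encode-injective s t (isV₁⇒topPositive s s∈) top eq) s∈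

  φ-encode : ∀ t → T (topPositive t) → φ (encode t)
  φ-encode t top = leading (encode-leader t top)
    where
    leading : ∃[ i ] i Subset.∈ encode t × sgn i ≡ ⊕ × (∀ {j} → j Subset.∈ encode t → idx j Fin.≤ idx i) →
              φ (encode t)
    leading (l , l∈ , plus , largest) =
      (λ {i} {j} i∈ j∈ eq → encode-idx-injective t i∈ j∈ (∣b∣≈∣b∣⁻ {i} {j} eq)) ,
      l , l∈ , (λ {j} j∈ → ∣b∣≤∣b∣⁺ {j} {l} (largest j∈)) , subst (0ℝ <_) (sym (b-⊕ l plus)) (0<x (idx l))

  φ-decode : ∀ S → φ S → ∃[ t ] encode t ≡ S × T (topPositive t)
  φ-decode S (distinct , i , i∈ , largest , 0<bi) =
    decode , encode-decode , decode-topPositive i∈ (0<b⇒⊕ i 0<bi) (λ {j} j∈ → ∣b∣≤∣b∣⁻ {j} {i} (largest j∈))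
    where open Decoding S (λ {i} {j} i∈ j∈ eq → distinct i∈ j∈ (∣b∣≈∣b∣⁺ {i} {j} eq))

  V₂-encode : ∀ t → T (isV₂ (suc k) t) → V₂ (encode t)
  V₂-encode t v = φ-encode t (proj₁ (isV₂⁻ t v)) , λ v₁ → proj₂ (isV₂⁻ t v) (V₁-encode⁻ t (proj₁ (isV₂⁻ t v)) v₁)

  V₂-decode : ∀ S → V₂ S → ∃[ t ] encode t ≡ S × T (isV₂ (suc k) t)
  V₂-decode S (S∈φ , ¬v₁) = transfer (φ-decode S S∈φ)
    where
    transfer : ∃[ t ] encode t ≡ S × T (topPositive t) → ∃[ t ] encode t ≡ S × T (isV₂ (suc k) t)
    transfer (t , eq , top) = t , eq , isV₂⁺ t top λ v → ¬v₁ (subst V₁ eq (V₁-encode⁺ t v))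

  -- An inclusion between predicates on ℝ is tested at the elements `b i` or `abs (b i)` themselves.
  -- Each is some `x (idx i)`, and `x` is injective up to `_≈_`, so what remains is an inclusion of
  -- supports.
  Joined⇔nested : ∀ s t → T (isV₁ (suc k) s) → T (isV₂ (suc k) t) →
                  T (nested (supp s) (supp t)) ⇔ Joined (encode s) (encode t)
  Joined⇔nested s t s∈ t∈ = mk⇔
    (λ h → V₁-encode⁺ s s∈ , V₂-encode t t∈ , Sum.map below⁺ above⁺ (nested⁻ {p = supp s} h))
    λ h → nested⁺ {p = supp s} (Sum.map below⁻ above⁻ (proj₂ (proj₂ h)))
    where
    pos : T (positive s)
    pos = proj₁ (isV₁⁻ s s∈)
    tops : T (topPositive s)
    tops = isV₁⇒topPositive s s∈
    topt : T (topPositive t)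
    topt = proj₁ (isV₂⁻ t t∈)

    b≡x : ∀ {i} → i Subset.∈ encode s → b i ≡ x (idx i)
    b≡x {i} i∈ = b-⊕ i (encode-positive s pos i∈)

    below⁺ : supp s ⊆ supp t → ⟦ encode s ⟧ Pred.⊆ encode t †
    below⁺ s⊆t {r} (i , i∈ , r≈bi) =
      let i′ , i′∈ , eq = ≢𝟘⇒∈-encode t topt (idx i) (∈-supp⁻ t (s⊆t (∈-supp⁺ s (∈-encode⇒≢𝟘 s i∈)))) in
      i′ , i′∈ , ≈-respʳ-≐ {r} {x (idx i′)} {abs (b i′)} (≐-sym {abs (b i′)} {x (idx i′)} (∣b∣≐x i′))
        (subst (r ≈_) (trans (b≡x i∈) (cong x (sym eq))) r≈bi)

    above⁺ : supp t ⊆ supp s → encode t † Pred.⊆ ⟦ encode s ⟧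
    above⁺ t⊆s {r} (i , i∈ , r≈∣bi∣) =
      let i′ , i′∈ , eq = ≢𝟘⇒∈-encode s tops (idx i) (∈-supp⁻ s (t⊆s (∈-supp⁺ t (∈-encode⇒≢𝟘 t i∈)))) in
      i′ , i′∈ , subst (r ≈_) (sym (trans (b≡x i′∈) (cong x eq)))
        (≈-respʳ-≐ {r} {abs (b i)} {x (idx i)} (∣b∣≐x i) r≈∣bi∣)

    below⁻ : ⟦ encode s ⟧ Pred.⊆ encode t † → supp s ⊆ supp t
    below⁻ h {j} j∈ =
      let i , i∈ , eq = ≢𝟘⇒∈-encode s tops j (∈-supp⁻ s j∈)
          i′ , i′∈ , e = h {b i} (i , i∈ , ≈-refl {b i})
          idx≡ = x-injective {idx i} {idx i′} (≈-respʳ-≐ {x (idx i)} {abs (b i′)} {x (idx i′)} (∣b∣≐x i′)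
                   (subst (_≈ abs (b i′)) (b≡x i∈) e))
      in subst (Subset._∈ supp t) (trans (sym idx≡) eq) (∈-supp⁺ t (∈-encode⇒≢𝟘 t i′∈))

    above⁻ : encode t † Pred.⊆ ⟦ encode s ⟧ → supp t ⊆ supp s
    above⁻ h {j} j∈ =
      let i , i∈ , eq = ≢𝟘⇒∈-encode t topt j (∈-supp⁻ t j∈)
          i′ , i′∈ , e = h {abs (b i)} (i , i∈ , ≈-refl {abs (b i)})
          idx≡ = x-injective {idx i} {idx i′} (≈-respˡ-≐ {abs (b i)} {x (idx i)} {x (idx i′)} (∣b∣≐x i)
                   (subst (abs (b i) ≈_) (b≡x i′∈) e))
      in subst (Subset._∈ supp s) (trans (sym idx≡) eq) (∈-supp⁺ s (∈-encode⇒≢𝟘 s i′∈))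

-- The graph H_B(n, k)

module _ {n k : ℕ} (1+k<n : suc k <ℕ n) (x : Fin n → ℝ) (0<x : ∀ i → 0ℝ < x i)
         (x-mono : ∀ {i j} → i <ᶠ j → x i < x j) where

  open BipartiteKneserB n (suc k) x
  open SignedSubsets n using (encode; encode-injective)
  open Encoding n k x 0<x x-mono
  open SimpleGraph H using (Adj; _≈ᵥ_)

  colour : Vertex → Bool
  colour (_ , inj₁ _) = true
  colour (_ , inj₂ _) = false

  V₁⇒colour : ∀ {u} → V₁ (proj₁ u) → colour u ≡ true
  V₁⇒colour {_ , inj₁ _} _  = refl
  V₁⇒colour {_ , inj₂ (_ , ¬v₁)} v₁ = contradiction v₁ ¬v₁

  V₂⇒colour : ∀ {u} → V₂ (proj₁ u) → colour u ≡ false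
  V₂⇒colour {_ , inj₁ v₁} (_ , ¬v₁) = contradiction v₁ ¬v₁
  V₂⇒colour {_ , inj₂ _}  _         = refl

  colour⇒V₁ : ∀ {u} → colour u ≡ true → V₁ (proj₁ u)
  colour⇒V₁ {_ , inj₁ v₁} _ = v₁

  colour⇒V₂ : ∀ {u} → colour u ≡ false → V₂ (proj₁ u)
  colour⇒V₂ {_ , inj₂ v₂} _ = v₂

  -- Equal sets may carry different membership proofs, but V₂ excludes V₁, so the set determines the
  -- tag.
  colour-cong : ∀ {u v} → u ≈ᵥ v → colour u ≡ colour v
  colour-cong {_ , inj₁ v₁} {v} refl = sym (V₁⇒colour {v} v₁)
  colour-cong {_ , inj₂ v₂} {v} refl = sym (V₂⇒colour {v} v₂)

  colour-adj : ∀ {u v} → Adj u v → colour v ≡ not (colour u)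
  colour-adj {u} {v} (inj₁ (v₁ , v₂ , _)) = trans (V₂⇒colour {v} v₂) (cong not (sym (V₁⇒colour {u} v₁)))
  colour-adj {u} {v} (inj₂ (v₁ , v₂ , _)) = trans (V₁⇒colour {v} v₁) (cong not (sym (V₂⇒colour {u} v₂)))

  code : Vertex → Signed n
  code (S , inj₁ v₁) = proj₁ (V₁-decode S v₁)
  code (S , inj₂ v₂) = proj₁ (V₂-decode S v₂)

  encode-code : ∀ u → encode (code u) ≡ proj₁ u
  encode-code (S , inj₁ v₁) = proj₁ (proj₂ (V₁-decode S v₁))
  encode-code (S , inj₂ v₂) = proj₁ (proj₂ (V₂-decode S v₂))

  code-isV₁ : ∀ {u} → colour u ≡ true → T (isV₁ (suc k) (code u))
  code-isV₁ {S , inj₁ v₁} _ = proj₂ (proj₂ (V₁-decode S v₁))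

  code-isV₂ : ∀ {u} → colour u ≡ false → T (isV₂ (suc k) (code u))
  code-isV₂ {S , inj₂ v₂} _ = proj₂ (proj₂ (V₂-decode S v₂))

  code-topPositive : ∀ u → T (topPositive (code u))
  code-topPositive u@(_ , inj₁ _) = isV₁⇒topPositive (code u) (code-isV₁ {u} refl)
  code-topPositive u@(_ , inj₂ _) = proj₁ (isV₂⁻ (code u) (code-isV₂ {u} refl))

  -- A code is extracted from a membership proof, yet depends on the set alone: `encode` returns the
  -- set and is injective on vectors leading with `⊕`.
  code-cong : ∀ {u v} → u ≈ᵥ v → code u ≡ code v
  code-cong {u} {v} eq = encode-injective (code u) (code v) (code-topPositive u) (code-topPositive v)
    (trans (encode-code u) (trans eq (sym (encode-code v))))

  code-injective : ∀ {u v} → code u ≡ code v → u ≈ᵥ v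
  code-injective {u} {v} eq = trans (sym (encode-code u)) (trans (cong encode eq) (encode-code v))

  vertex₁ : ∀ t → T (isV₁ (suc k) t) → Vertex
  vertex₁ t t∈ = encode t , inj₁ (V₁-encode⁺ t t∈)

  vertex₂ : ∀ t → T (isV₂ (suc k) t) → Vertex
  vertex₂ t t∈ = encode t , inj₂ (V₂-encode t t∈)

  code-vertex₁ : ∀ t (t∈ : T (isV₁ (suc k) t)) → code (vertex₁ t t∈) ≡ t
  code-vertex₁ t t∈ = encode-injective (code (vertex₁ t t∈)) t (code-topPositive (vertex₁ t t∈))
    (isV₁⇒topPositive t t∈) (encode-code (vertex₁ t t∈))

  code-vertex₂ : ∀ t (t∈ : T (isV₂ (suc k) t)) → code (vertex₂ t t∈) ≡ t
  code-vertex₂ t t∈ = encode-injective (code (vertex₂ t t∈)) t (code-topPositive (vertex₂ t t∈))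
    (proj₁ (isV₂⁻ t t∈)) (encode-code (vertex₂ t t∈))

  nested⇔Adj : ∀ {u v} → colour u ≡ true → colour v ≡ false →
               T (nested (supp (code u)) (supp (code v))) ⇔ Adj u v
  nested⇔Adj {u} {v} cu cv = mk⇔
    (λ h → inj₁ (subst₂ Joined (encode-code u) (encode-code v) (Equivalence.to joined h)))
    [ (λ j → Equivalence.from joined (subst₂ Joined (sym (encode-code u)) (sym (encode-code v)) j))
    , (λ (v₁ , _) → contradiction v₁ (proj₂ (colour⇒V₂ {v} cv))) ]′
    where
    joined : T (nested (supp (code u)) (supp (code v))) ⇔ Joined (encode (code u)) (encode (code v))
    joined = Joined⇔nested (code u) (code v) (code-isV₁ {u} cu) (code-isV₂ {v} cv)

  full : Signed n
  full = embed ⊤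

  full-isV₂ : T (isV₂ (suc k) full)
  full-isV₂ = isV₂⁺ full
    -- The full vector passes the V₁ test for size `n`, here in the form `suc (pred n)`, which
    -- yields its leading `⊕`; it fails the test for `suc k` because `suc k` is less than `n`.
    (isV₁⇒topPositive {k = ℕ.pred n} full (isV₁⁺ full (embed-positive {n} ⊤)
      (trans ∣full∣ (sym (ℕ.suc-pred n {{ℕ.>-nonZero (ℕ.≤-<-trans z≤n 1+k<n)}})))))
    λ v → ℕ.<⇒≢ 1+k<n (trans (sym (proj₂ (isV₁⁻ full v))) ∣full∣)
    where
    ∣full∣ : ∣ supp full ∣ ≡ n
    ∣full∣ = trans (cong ∣_∣ (supp-embed {n} ⊤)) (∣⊤∣≡n n)

  hub : Vertex
  hub = vertex₂ full full-isV₂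

  hub-adj : ∀ {u} → colour u ≡ true → Adj u hub
  hub-adj {u} cu = Equivalence.to (nested⇔Adj {u} {hub} cu refl)
    (nested⁺ {p = supp (code u)} (inj₁ (subst (supp (code u) ⊆_)
      (sym (trans (cong supp (code-vertex₂ full full-isV₂)) (supp-embed ⊤))) ⊆⊤)))

  neighbour : ∀ {v} → colour v ≡ false → ∃[ u ] Adj v u
  neighbour {v} cv = adjacent (comparable-of-size (supp (code v)) (ℕ.<⇒≤ 1+k<n))
    where
    adjacent : ∃[ p ] ∣ p ∣ ≡ suc k × (p ⊆ supp (code v) ⊎ supp (code v) ⊆ p) → ∃[ u ] Adj v u
    adjacent (p , w , c) = u , Sum.swap (Equivalence.to (nested⇔Adj {u} {v} refl cv)
        (subst (λ q → T (nested q (supp (code v)))) (sym supp-u) (nested⁺ {p = p} c)))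
      where
      p∈ : T (isV₁ (suc k) (embed p))
      p∈ = isV₁⁺ (embed p) (embed-positive p) (trans (cong ∣_∣ (supp-embed p)) w)
      u : Vertex
      u = vertex₁ (embed p) p∈
      supp-u : supp (code u) ≡ p
      supp-u = trans (cong supp (code-vertex₁ (embed p) p∈)) (supp-embed p)

  L₁ L₂ : List (Signed n)
  L₁ = filterᵇ (isV₁ (suc k)) (signed n)
  L₂ = filterᵇ (isV₂ (suc k)) (signed n)

  L₁⇒isV₁ : ∀ {t} → t ∈ L₁ → T (isV₁ (suc k) t)
  L₁⇒isV₁ t∈ = proj₂ (∈-filter⁻ (T? ∘ isV₁ (suc k)) {xs = signed n} t∈)

  L₂⇒isV₂ : ∀ {t} → t ∈ L₂ → T (isV₂ (suc k) t)
  L₂⇒isV₂ t∈ = proj₂ (∈-filter⁻ (T? ∘ isV₂ (suc k)) {xs = signed n} t∈)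

  L₁-vertex : ∀ {t} → t ∈ L₁ → ∃[ u ] colour u ≡ true × code u ≡ t
  L₁-vertex {t} t∈ = vertex₁ t (L₁⇒isV₁ t∈) , refl , code-vertex₁ t (L₁⇒isV₁ t∈)

  L₂-vertex : ∀ {t} → t ∈ L₂ → ∃[ u ] colour u ≡ false × code u ≡ t
  L₂-vertex {t} t∈ = vertex₂ t (L₂⇒isV₂ t∈) , refl , code-vertex₂ t (L₂⇒isV₂ t∈)

  length-L₁ : length L₁ ≡ n C suc k
  length-L₁ = trans (length-filterᵇ-signed n (isV₁ (suc k))) (#-isV₁ n (suc k))

  length-L₂ : length L₂ ≡ (3 ^ n ∸ 1) / 2 ∸ n C suc k
  length-L₂ = trans (length-filterᵇ-signed n (isV₂ (suc k))) (#-isV₂ n k)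

  degree : ∀ {s} → s ∈ L₁ → length (filter (λ t → T? (nested (supp s) (supp t))) L₂)
             ≡ (3 ^ suc k ∸ 3) / 2 + 2 ^ k * (3 ^ (n ∸ suc k) ∸ 1)
  degree {s} s∈ = begin
    length (filterᵇ (nested (supp s) ∘ supp) L₂)
      ≡⟨ length-filterᵇ-filterᵇ (isV₂ (suc k)) (nested (supp s) ∘ supp) (signed n) ⟩
    length (filterᵇ (λ t → isV₂ (suc k) t ∧ nested (supp s) (supp t)) (signed n))
      ≡⟨ length-filterᵇ-signed n (λ t → isV₂ (suc k) t ∧ nested (supp s) (supp t)) ⟩
    # (λ t → isV₂ (suc k) t ∧ nested (supp s) (supp t))
      ≡⟨ #-isV₂-nested s (L₁⇒isV₁ s∈) ⟩
    (3 ^ suc k ∸ 3) / 2 + 2 ^ k * (3 ^ (n ∸ suc k) ∸ 1) ∎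
    where open ≡-Reasoning

  open HubbedBipartite H colour (λ {u} {v} → colour-cong {u} {v}) (λ {u} {v} → colour-adj {u} {v})
    hub (λ {u} → hub-adj {u}) (λ {v} → neighbour {v})

  open Counting (λ {u} {v} → code-cong {u} {v}) (λ {u} {v} → code-injective {u} {v})
    (Unique.filter⁺ (T? ∘ isV₁ (suc k)) (signed-unique n))
    (Unique.filter⁺ (T? ∘ isV₂ (suc k)) (signed-unique n))
    (λ {u} cu → ∈-filter⁺ (T? ∘ isV₁ (suc k)) (∈-signed (code u)) (code-isV₁ {u} cu))
    (λ {u} cu → ∈-filter⁺ (T? ∘ isV₂ (suc k)) (∈-signed (code u)) (code-isV₂ {u} cu))
    L₁-vertex L₂-vertex
    (λ (s , t) → T? (nested (supp s) (supp t)))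
    (λ {u} {v} → nested⇔Adj {u} {v})
    degree

  sizes :
      (pairs 1 HasSize (n C suc k) * ((3 ^ suc k ∸ 3) / 2 + 2 ^ k * (3 ^ (n ∸ suc k) ∸ 1)))
    × (pairs 3 HasSize (n C suc k) * ((3 ^ n ∸ 1) / 2 ∸ (n C suc k) ∸ (3 ^ suc k ∸ 3) / 2 ∸ 2 ^ k * (3 ^ (n ∸ suc k) ∸ 1)))
    × (pairsV₁ 2 HasSize ((n C suc k) C 2))
    × (∃[ d₂ ] ∃[ d₄ ] (pairsV₂ 2 HasSize d₂) × (pairsV₂ 4 HasSize d₄)
        × d₂ + d₄ ≡ ((3 ^ n ∸ 1) / 2 ∸ (n C suc k)) C 2)
  sizes =
    subst (pairs 1 HasSize_) (cong (_* (smaller + larger)) length-L₁) size-1 ,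
    subst (pairs 3 HasSize_) (cong₂ _*_ length-L₁ (trans (cong (_∸ (smaller + larger)) length-L₂)
      (sym (ℕ.∸-+-assoc ((3 ^ n ∸ 1) / 2 ∸ n C suc k) smaller larger)))) size-3 ,
    subst (pairsV₁ 2 HasSize_) (cong (_C 2) length-L₁)
      (size-2₁ (λ {u} → V₁⇒colour {u}) (λ {u} → colour⇒V₁ {u})) ,
    subst (λ l → ∃[ d₂ ] ∃[ d₄ ] (pairsV₂ 2 HasSize d₂) × (pairsV₂ 4 HasSize d₄) × d₂ + d₄ ≡ l C 2) length-L₂
      (size-2-4₂ (λ {u} → V₂⇒colour {u}) (λ {u} → colour⇒V₂ {u}))
    where
    smaller larger : ℕ
    smaller = (3 ^ suc k ∸ 3) / 2
    larger = 2 ^ k * (3 ^ (n ∸ suc k) ∸ 1)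

mainTheorem15 : ∀ (n k : ℕ) → 2 <ℕ n → 1 <ℕ k → k <ℕ n →
    (x : Fin n → ℝ) → (∀ i → 0ℝ < x i) → (∀ {i j} → i <ᶠ j → x i < x j) →
    let open BipartiteKneserB n k x in
      -- every _∸_ and _/ 2 below is exact, for 1 < k < n
    (pairs 1 HasSize (n C k) * ((3 ^ k ∸ 3) / 2 + 2 ^ (k ∸ 1) * (3 ^ (n ∸ k) ∸ 1)))
    × (pairs 3 HasSize (n C k) * ((3 ^ n ∸ 1) / 2 ∸ (n C k) ∸ (3 ^ k ∸ 3) / 2 ∸ 2 ^ (k ∸ 1) * (3 ^ (n ∸ k) ∸ 1)))
    × (pairsV₁ 2 HasSize ((n C k) C 2))
    × (∃[ d₂ ] ∃[ d₄ ] (pairsV₂ 2 HasSize d₂) × (pairsV₂ 4 HasSize d₄)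
    × d₂ + d₄ ≡ ((3 ^ n ∸ 1) / 2 ∸ (n C k)) C 2)
mainTheorem15 n (suc k) _ _ k<n x 0<x x-mono = sizes k<n x 0<x x-mono
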